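{- Let $P$ be a set of prime numbers, $G$ a pro-$P$ group, $\Omega\cong\mathbb Z_P=\prod_{p\in P}\mathbb Z_p$ with a fixed topological generator $\omega$, and $d:G\to\Omega$ a surjective continuous homomorphism. Let $H$ be an inertially finite subgroup of $G$, let $U$ be an open subgroup of $H$ and let $h\in H$ with $d_H(h)\in\Omega^+$. Then there exists a unique Frobenius group $\Sigma_{h,H|U}$ for $h$ relative to $U$, and it is explicitly given by $\Sigma_{h,H|U}=\langle h\rangle_{\mathrm c}\cdot I_U$.
   Context: $\langle h\rangle_{\mathrm c}$ is the closure of the subgroup generated by $h$. For closed subgroups $K\le H$ of $G$: $I_H=H\cap\ker d$, $f_{H|K}=[d(H):d(K)]$, $f_H=f_{G|H}=[\Omega:d(H)]$. $H$ is inertially finite if it is closed and $f_H<\infty$; then $d(H)=f_H\Omega$ and $d_H=\frac1{f_H}d|_H:H\to\Omega$ (well defined since $\Omega$ is torsion-free) is surjective with kernel $I_H$. $\Omega^+=\{n\omega:n\in\mathbb N_{>0}\}$, and for $x\in\Omega^+$, $\mathrm{mult}(x)$ denotes the unique $n\in\mathbb N_{>0}$ with $x=n\omega$. For $n=\prod_pp^{n(p)}\in\mathbb N_{>0}$ put $P(n)=\prod_{p\in P}p^{n(p)}$, and for $h\in H$ with $d_H(h)\in\Omega^+$ put $P(d_H(h))=P(\mathrm{mult}(d_H(h)))$. For $H$ an inertially finite subgroup of $G$, $U$ an open subgroup of $H$ and $h\in H$, a Frobenius group for $h$ relative to $U$ is an open subgroup $\Sigma$ of $H$ such that $h\in\Sigma$;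 $d_H(h)\in\Omega^+$ and $f_{H|\Sigma}=P(d_H(h))$; and $I_\Sigma=I_U$.
   Formalization: The added hypothesis that h normalizes I_U (automatic if U is normal in H) is necessary: for G=H=D₄×ℤ₂ (P={2}), d the second projection, U=⟨s⟩×ℤ₂, h=(r,1), no Frobenius group exists; existence of a Frobenius group always forces it. -}

module Defs where

open import Algebra.Bundles using (Group)
open import Algebra.Definitions.RawMonoid using (_×_)
open import Algebra.Morphism.Structures using (module GroupMorphisms)
import Algebra.Properties.Group as GroupProperties
open import Data.Fin.Base using (Fin)
open import Data.Integer.Base as ℤ using (ℤ; +_; 0ℤ)
import Data.Integer.Divisibility.Signed as ℤ
import Data.Integer.Properties as ℤ
open import Data.Integer.Tactic.RingSolver using (solve-∀)
open import Data.List.Base using (List; filter)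
open import Data.List.Relation.Unary.Any using (Any)
open import Data.Nat.Base as ℕ using (ℕ; NonZero; _^_)
open import Data.Nat.Divisibility using (_∣_)
open import Data.Nat.ListAction using (product)
import Data.Nat.Properties as ℕ
open import Data.Nat.Primality using (Prime)
open import Data.Nat.Primality.Factorisation using (factorise; factors)
open import Data.Product.Base as Product using (Σ; ∃; ∃-syntax; Σ-syntax; _,_; proj₁; proj₂)
open import Data.Unit.Polymorphic.Base using (⊤; tt)
open import Function.Base using (_∘_)
open import Function.Bundles using (Inverse; _⇔_; mk⇔)
open import Function.Definitions using (Inverseᵇ; Surjective)
open import Level using (Level; Lift; lift; lower; suc; _⊔_; 0ℓ)
open import Relation.Binary.Bundles using (Setoid)
open import Relation.Binary.Definitions using (_Respects_)
open import Relation.Binary.PropositionalEquality as ≡ using (_≡_)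
import Relation.Binary.Reasoning.Setoid as SetoidReasoning
open import Relation.Nullary.Negation.Core using (¬_)
open import Relation.Unary using (Pred; Decidable; _∈_; _⊆_; _≐_; _≬_; _∩_; ∁; U; ⋃)

private
  variable
    a b g o ℓ : Level

_∧_ : Set a → Set b → Set (a ⊔ b)
_∧_ = Product._×_

infixr 2 _∧_

------------------------------------------------------------------------
-- Topological groups

-- Open sets are predicates on the carrier at the level of the carrier;
-- `IsOpen` lives one level up, so that it may quantify over such sets.

record Topology (S : Setoid ℓ ℓ) : Set (suc (suc ℓ)) where
  open Setoid S
  field
    IsOpen       : Pred (Pred Carrier ℓ) (suc ℓ)
    open-resp-≈  : ∀ {V} → IsOpen V → V Respects _≈_
    open-resp-≐  : ∀ {V W} → V ≐ W → IsOpen V → IsOpen W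
    open-⊤       : IsOpen (λ _ → ⊤)
    open-∩       : ∀ {V W} → IsOpen V → IsOpen W → IsOpen (V ∩ W)
    open-⋃       : ∀ {I : Set ℓ} {V : I → Pred Carrier ℓ} →
                   (∀ i → IsOpen (V i)) → IsOpen (⋃ I V)

record TopologicalGroup ℓ : Set (suc (suc ℓ)) where
  field
    group    : Group ℓ ℓ
  open Group group public
  field
    topology : Topology setoid
  open Topology topology public
  field
    ∙-continuous  : ∀ {x y V} → IsOpen V → (x ∙ y) ∈ V →
                    ∃[ A ] ∃[ B ] IsOpen A ∧ IsOpen B ∧ x ∈ A ∧ y ∈ B ∧
                    (∀ {a b} → a ∈ A → b ∈ B → (a ∙ b) ∈ V)
    ⁻¹-continuous : ∀ {V} → IsOpen V → IsOpen (λ x → (x ⁻¹) ∈ V)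

module _ (G : TopologicalGroup g) (K : TopologicalGroup o) where
  private
    module G = TopologicalGroup G
    module K = TopologicalGroup K
  open GroupMorphisms G.rawGroup K.rawGroup using (IsGroupHomomorphism)

  -- Continuity at every point; this form makes sense when G and K live
  -- in different universes.
  Continuous : (G.Carrier → K.Carrier) → Set (suc g ⊔ suc o)
  Continuous f = ∀ {x W} → K.IsOpen W → f x ∈ W →
    ∃[ V ] G.IsOpen V ∧ x ∈ V ∧ (∀ {y} → y ∈ V → f y ∈ W)

  record ContinuousHom : Set (suc g ⊔ suc o) where
    field
      ⟦_⟧            : G.Carrier → K.Carrier
      isHomomorphism : IsGroupHomomorphism ⟦_⟧
      continuous     : Continuous ⟦_⟧

_IsSurjective : {G : TopologicalGroup g} {K : TopologicalGroup o} → ContinuousHom G K → Set (g ⊔ o)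
_IsSurjective {G = G} {K} f =
  Surjective (TopologicalGroup._≈_ G) (TopologicalGroup._≈_ K) (ContinuousHom.⟦_⟧ f)

infix 4 _≅_

record _≅_ (G : TopologicalGroup g) (K : TopologicalGroup o) : Set (suc g ⊔ suc o) where
  private
    module G = TopologicalGroup G
    module K = TopologicalGroup K
  field
    to              : ContinuousHom G K
    from            : K.Carrier → G.Carrier
    inverse         : Inverseᵇ G._≈_ K._≈_ (ContinuousHom.⟦_⟧ to) from
    from-continuous : Continuous K G from

------------------------------------------------------------------------
-- Subgroups

record Subgroup (G : TopologicalGroup g) ℓ : Set (g ⊔ suc ℓ) where
  open TopologicalGroup G
  field
    ⟨_⟩   : Pred Carrier ℓ
    resp  : ⟨_⟩ Respects _≈_
    ε∈    : ε ∈ ⟨_⟩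
    ∙∈    : ∀ {x y} → x ∈ ⟨_⟩ → y ∈ ⟨_⟩ → (x ∙ y) ∈ ⟨_⟩
    ⁻¹∈   : ∀ {x} → x ∈ ⟨_⟩ → (x ⁻¹) ∈ ⟨_⟩

open Subgroup public using (⟨_⟩)

module _ {G : TopologicalGroup g} where
  open TopologicalGroup G
  open GroupProperties group
  open SetoidReasoning setoid

  whole : Subgroup G 0ℓ
  whole = record
    { ⟨_⟩ = U ; resp = λ _ _ → _ ; ε∈ = _ ; ∙∈ = λ _ _ → _ ; ⁻¹∈ = λ _ → _ }

  IsNormal : Subgroup G ℓ → Set (g ⊔ ℓ)
  IsNormal N = ∀ y {x} → x ∈ ⟨ N ⟩ → (y ∙ x ∙ y ⁻¹) ∈ ⟨ N ⟩

  Normalizes : Carrier → Pred Carrier ℓ → Set (g ⊔ ℓ)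
  Normalizes h A = ∀ x → x ∈ A ⇔ (h ∙ x ∙ h ⁻¹) ∈ A

  IsClosed : Pred Carrier g → Set (suc g)
  IsClosed A = IsOpen (∁ A)

  -- V is a subgroup of H that is open for the subspace topology of H.
  _IsOpenSubgroupOf_ : Subgroup G g → Subgroup G g → Set (suc g)
  V IsOpenSubgroupOf H =
    ⟨ V ⟩ ⊆ ⟨ H ⟩ ∧ (∃[ W ] IsOpen W ∧ ⟨ V ⟩ ≐ (W ∩ ⟨ H ⟩))

  closure : Pred Carrier ℓ → Pred Carrier (suc g ⊔ ℓ)
  closure A x = ∀ {V} → IsOpen V → x ∈ V → V ≬ A

  data Generated (h : Carrier) : Pred Carrier g where
    gen  : h ∈ Generated h
    unit : ε ∈ Generated h
    mul  : ∀ {x y} → x ∈ Generated h → y ∈ Generated h → (x ∙ y) ∈ Generated h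
    inv  : ∀ {x} → x ∈ Generated h → (x ⁻¹) ∈ Generated h
    resp : Generated h Respects _≈_

  ⟨_⟩ᶜ : Carrier → Pred Carrier (suc g)
  ⟨ h ⟩ᶜ = closure (Generated h)

  infixl 7 _·_

  _·_ : Pred Carrier a → Pred Carrier b → Pred Carrier (g ⊔ a ⊔ b)
  (A · B) x = ∃[ y ] ∃[ z ] y ∈ A ∧ z ∈ B ∧ x ≈ y ∙ z

  LeftCosets : Subgroup G a → Subgroup G b → Setoid (g ⊔ a) b
  LeftCosets A B = record
    { Carrier       = ∃ ⟨ A ⟩
    ; _≈_           = λ (x , _) (y , _) → (x ⁻¹ ∙ y) ∈ ⟨ B ⟩
    ; isEquivalence = record
      { refl  = λ {(x , _)} → B.resp (sym (inverseˡ x)) B.ε∈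
      ; sym   = λ {(x , _)} {(y , _)} p → B.resp (flip x y) (B.⁻¹∈ p)
      ; trans = λ {(x , _)} {(y , _)} {(z , _)} p q → B.resp (join x y z) (B.∙∈ p q)
      }
    }
    where
    module B = Subgroup B
    flip : ∀ x y → (x ⁻¹ ∙ y) ⁻¹ ≈ y ⁻¹ ∙ x
    flip x y = begin
      (x ⁻¹ ∙ y) ⁻¹    ≈⟨ ⁻¹-anti-homo-∙ _ _ ⟩
      y ⁻¹ ∙ x ⁻¹ ⁻¹   ≈⟨ ∙-congˡ (⁻¹-involutive x) ⟩
      y ⁻¹ ∙ x         ∎
    join : ∀ x y z → (x ⁻¹ ∙ y) ∙ (y ⁻¹ ∙ z) ≈ x ⁻¹ ∙ z
    join x y z = begin
      (x ⁻¹ ∙ y) ∙ (y ⁻¹ ∙ z)  ≈⟨ assoc _ _ _ ⟩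
      x ⁻¹ ∙ (y ∙ (y ⁻¹ ∙ z))  ≈⟨ ∙-congˡ (\\-leftDividesˡ y z) ⟩
      x ⁻¹ ∙ z                 ∎

  -- [ A ∶ B ]≡ n : the index of B in A is finite and equal to n (used
  -- only when B ⊆ A).
  [_∶_]≡_ : Subgroup G a → Subgroup G b → ℕ → Set (g ⊔ a ⊔ b)
  [ A ∶ B ]≡ n = Inverse (≡.setoid (Fin n)) (LeftCosets A B)

module _ {G : TopologicalGroup g} {K : TopologicalGroup o} (f : ContinuousHom G K) where
  private
    module G = TopologicalGroup G
    module K = TopologicalGroup K
  open ContinuousHom f
  open GroupMorphisms.IsGroupHomomorphism isHomomorphism

  image : Subgroup G ℓ → Subgroup K (g ⊔ o ⊔ ℓ)
  image A = record
    { ⟨_⟩  = λ y → ∃[ x ] x ∈ ⟨ A ⟩ ∧ ⟦ x ⟧ K.≈ y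
    ; resp = λ y≈z (x , x∈A , eq) → x , x∈A , K.trans eq y≈z
    ; ε∈   = G.ε , A.ε∈ , ε-homo
    ; ∙∈   = λ (x , x∈A , p) (y , y∈A , q) →
               x G.∙ y , A.∙∈ x∈A y∈A , K.trans (homo x y) (K.∙-cong p q)
    ; ⁻¹∈  = λ (x , x∈A , p) → x G.⁻¹ , A.⁻¹∈ x∈A , K.trans (⁻¹-homo x) (K.⁻¹-cong p)
    }
    where module A = Subgroup A

  kernel : Pred G.Carrier o
  kernel x = ⟦ x ⟧ K.≈ K.ε

------------------------------------------------------------------------
-- Profinite and pro-P groups

module _ (G : TopologicalGroup g) where
  open TopologicalGroup G

  -- Covers indexed by small types suffice: a cover indexed by a large
  -- type can be thinned out to one indexed by the carrier.
  IsCompact : Set (suc g)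
  IsCompact = ∀ {I : Set g} (V : I → Pred Carrier g) → (∀ i → IsOpen (V i)) →
    (∀ x → ∃[ i ] x ∈ V i) → ∃[ is ] (∀ x → Any (λ i → x ∈ V i) is)

  IsHausdorff : Set (suc g)
  IsHausdorff = ∀ {x y} → ¬ x ≈ y →
    ∃[ V ] ∃[ W ] IsOpen V ∧ IsOpen W ∧ x ∈ V ∧ y ∈ W ∧ ¬ (V ≬ W)

  -- Neukirch's definition: compact, Hausdorff, and with a basis of
  -- neighbourhoods of the identity consisting of normal subgroups.
  record IsProfinite : Set (suc g) where
    field
      compact   : IsCompact
      hausdorff : IsHausdorff
      basis     : ∀ {V} → IsOpen V → ε ∈ V →
                  Σ[ N ∈ Subgroup G g ] IsNormal N ∧ IsOpen ⟨ N ⟩ ∧ ⟨ N ⟩ ⊆ V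

  -- All the finite quotients G / N, N open and normal, are P-groups, that
  -- is, the primes dividing their orders belong to P.
  record IsPro (P : Pred ℕ 0ℓ) : Set (suc g) where
    field
      isProfinite : IsProfinite
      quotients   : (N : Subgroup G g) → IsNormal N → IsOpen ⟨ N ⟩ →
                    ∃[ n ] ([ whole {G = G} ∶ N ]≡ n) ∧ (∀ {p} → Prime p → p ∣ n → p ∈ P)

------------------------------------------------------------------------
-- The p-adic integers and ℤ_P

infix 4 _≡_[mod_]

record _≡_[mod_] (i j : ℤ) (m : ℕ) : Set where
  constructor mod
  field
    divides : + m ℤ.∣ i ℤ.- j

private
  module Mod (m : ℕ) where
    refl : ∀ {i} → i ≡ i [mod m ]
    refl {i} = mod (ℤ.divides 0ℤ (ℤ.+-inverseʳ i))

    reflexive : ∀ {i j} → i ≡ j → i ≡ j [mod m ]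
    reflexive ≡.refl = refl

    sym : ∀ {i j} → i ≡ j [mod m ] → j ≡ i [mod m ]
    sym {i} {j} (mod p) = mod (≡.subst (+ m ℤ.∣_) (eq i j) (ℤ.∣m⇒∣-m p))
      where
      eq : ∀ i j → ℤ.- (i ℤ.- j) ≡ j ℤ.- i
      eq = solve-∀

    trans : ∀ {i j k} → i ≡ j [mod m ] → j ≡ k [mod m ] → i ≡ k [mod m ]
    trans {i} {j} {k} (mod p) (mod q) = mod (≡.subst (+ m ℤ.∣_) (eq i j k) (ℤ.∣m∣n⇒∣m+n p q))
      where
      eq : ∀ i j k → (i ℤ.- j) ℤ.+ (j ℤ.- k) ≡ i ℤ.- k
      eq = solve-∀

    +-cong : ∀ {i j k l} → i ≡ j [mod m ] → k ≡ l [mod m ] → i ℤ.+ k ≡ j ℤ.+ l [mod m ]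
    +-cong {i} {j} {k} {l} (mod p) (mod q) = mod (≡.subst (+ m ℤ.∣_) (eq i j k l) (ℤ.∣m∣n⇒∣m+n p q))
      where
      eq : ∀ i j k l → (i ℤ.- j) ℤ.+ (k ℤ.- l) ≡ (i ℤ.+ k) ℤ.- (j ℤ.+ l)
      eq = solve-∀

    neg-cong : ∀ {i j} → i ≡ j [mod m ] → ℤ.- i ≡ ℤ.- j [mod m ]
    neg-cong {i} {j} (mod p) = mod (≡.subst (+ m ℤ.∣_) (eq i j) (ℤ.∣m⇒∣-m p))
      where
      eq : ∀ i j → ℤ.- (i ℤ.- j) ≡ ℤ.- i ℤ.- ℤ.- j
      eq = solve-∀

-- ℤ_p as the inverse limit of the groups ℤ/pⁿ: `residue n` represents the
-- component in ℤ/pⁿ.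
record ℤₚ (p : ℕ) : Set where
  field
    residue  : ℕ → ℤ
    coherent : ∀ n → residue (ℕ.suc n) ≡ residue n [mod p ^ n ]

open ℤₚ

module _ {p : ℕ} where

  _≈ₚ_ : ℤₚ p → ℤₚ p → Set
  x ≈ₚ y = ∀ n → residue x n ≡ residue y n [mod p ^ n ]

  _+ₚ_ : ℤₚ p → ℤₚ p → ℤₚ p
  x +ₚ y = record
    { residue  = λ n → residue x n ℤ.+ residue y n
    ; coherent = λ n → Mod.+-cong (p ^ n) (coherent x n) (coherent y n)
    }

  0ₚ : ℤₚ p
  0ₚ = record { residue = λ _ → 0ℤ ; coherent = λ n → Mod.refl (p ^ n) }

  -ₚ_ : ℤₚ p → ℤₚ p
  -ₚ x = record
    { residue  = λ n → ℤ.- residue x n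
    ; coherent = λ n → Mod.neg-cong (p ^ n) (coherent x n)
    }

module _ (P : Pred ℕ 0ℓ) where

  -- Membership in P is an irrelevant argument, so that there is exactly
  -- one factor ℤ_p for every p ∈ P.
  Πℤₚ : Set
  Πℤₚ = ∀ p → .(p ∈ P) → ℤₚ p

  Πℤₚ-group : Group 0ℓ 0ℓ
  Πℤₚ-group = record
    { Carrier = Πℤₚ
    ; _≈_     = λ x y → ∀ p .(p∈P : p ∈ P) → x p p∈P ≈ₚ y p p∈P
    ; _∙_     = λ x y p p∈P → x p p∈P +ₚ y p p∈P
    ; ε       = λ _ _ → 0ₚ
    ; _⁻¹     = λ x p p∈P → -ₚ x p p∈P
    ; isGroup = record
      { isMonoid = record
        { isSemigroup = record
          { isMagma = record
            { isEquivalence = record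
              { refl  = λ p _ n → Mod.refl (p ^ n)
              ; sym   = λ eq p p∈P n → Mod.sym (p ^ n) (eq p p∈P n)
              ; trans = λ eq₁ eq₂ p p∈P n → Mod.trans (p ^ n) (eq₁ p p∈P n) (eq₂ p p∈P n)
              }
            ; ∙-cong = λ eq₁ eq₂ p p∈P n → Mod.+-cong (p ^ n) (eq₁ p p∈P n) (eq₂ p p∈P n)
            }
          ; assoc = λ x y z p p∈P n → Mod.reflexive (p ^ n)
              (ℤ.+-assoc (residue (x p p∈P) n) (residue (y p p∈P) n) (residue (z p p∈P) n))
          }
        ; identity = (λ x p p∈P n → Mod.reflexive (p ^ n) (ℤ.+-identityˡ (residue (x p p∈P) n)))
                   , (λ x p p∈P n → Mod.reflexive (p ^ n) (ℤ.+-identityʳ (residue (x p p∈P) n)))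
        }
      ; inverse = (λ x p p∈P n → Mod.reflexive (p ^ n) (ℤ.+-inverseˡ (residue (x p p∈P) n)))
                , (λ x p p∈P n → Mod.reflexive (p ^ n) (ℤ.+-inverseʳ (residue (x p p∈P) n)))
      ; ⁻¹-cong = λ eq p p∈P n → Mod.neg-cong (p ^ n) (eq p p∈P n)
      }
    }

  -- Agree F m x y : the components of x and y at the primes p < F in P
  -- have the same image in ℤ/pᵐ.  The sets of all y with Agree F m x y
  -- form a basis of neighbourhoods of x in the product topology, every
  -- finite set of coordinates being contained in one of the form p < F.
  Agree : ℕ → ℕ → Πℤₚ → Πℤₚ → Set
  Agree F m x y = ∀ p .(p∈P : p ∈ P) → p ℕ.< F → ∀ n → n ℕ.≤ m →
    residue (x p p∈P) n ≡ residue (y p p∈P) n [mod p ^ n ]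

  private
    agree-weaken : ∀ {F F′ m m′} x y → F ℕ.≤ F′ → m ℕ.≤ m′ → Agree F′ m′ x y → Agree F m x y
    agree-weaken _ _ F≤ m≤ ag p p∈P p< n n≤ = ag p p∈P (ℕ.<-≤-trans p< F≤) n (ℕ.≤-trans n≤ m≤)

    agree-refl : ∀ {F m} x → Agree F m x x
    agree-refl x p _ _ n _ = Mod.refl (p ^ n)

    agree-trans : ∀ {F m} x y z → Agree F m x y → Agree F m y z → Agree F m x z
    agree-trans _ _ _ ag ag′ p p∈P p< n n≤ = Mod.trans (p ^ n) (ag p p∈P p< n n≤) (ag′ p p∈P p< n n≤)

  -- The additive topological group ℤ_P, the product of the ℤ_p over p ∈ P.
  ℤ[_] : TopologicalGroup 0ℓ
  ℤ[_] = record
    { group         = Πℤₚ-group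
    ; topology      = record
      { IsOpen      = IsOpenΠ
      ; open-resp-≈ = λ (lift V-open) {x} {y} x≈y x∈V →
          V-open x∈V .proj₂ .proj₂ (λ p p∈P _ n _ → x≈y p p∈P n)
      ; open-resp-≐ = λ (V⊆W , W⊆V) (lift V-open) → lift λ x∈W →
          let F , m , sub = V-open (W⊆V x∈W) in F , m , λ ag → V⊆W (sub ag)
      ; open-⊤      = lift λ _ → 0 , 0 , λ _ → tt
      ; open-∩      = λ (lift V-open) (lift W-open) → lift λ {x} (x∈V , x∈W) →
          let F₁ , m₁ , sub₁ = V-open x∈V
              F₂ , m₂ , sub₂ = W-open x∈W
          in F₁ ℕ.⊔ F₂ , m₁ ℕ.⊔ m₂ , λ {y} ag →
             sub₁ (agree-weaken x y (ℕ.m≤m⊔n F₁ F₂) (ℕ.m≤m⊔n m₁ m₂) ag) ,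
             sub₂ (agree-weaken x y (ℕ.m≤n⊔m F₁ F₂) (ℕ.m≤n⊔m m₁ m₂) ag)
      ; open-⋃      = λ V-open → lift λ (i , x∈Vᵢ) →
          let F , m , sub = lower (V-open i) x∈Vᵢ in F , m , λ ag → i , sub ag
      }
    ; ∙-continuous  = λ {x} {y} (lift V-open) xy∈V →
        let F , m , sub = V-open xy∈V in
        Agree F m x , Agree F m y , ball-open F m x , ball-open F m y ,
        agree-refl x , agree-refl y ,
        λ ag₁ ag₂ → sub (λ p p∈P p< n n≤ →
          Mod.+-cong (p ^ n) (ag₁ p p∈P p< n n≤) (ag₂ p p∈P p< n n≤))
    ; ⁻¹-continuous = λ (lift V-open) → lift λ x⁻¹∈V →
        let F , m , sub = V-open x⁻¹∈V in
        F , m , λ ag → sub (λ p p∈P p< n n≤ → Mod.neg-cong (p ^ n) (ag p p∈P p< n n≤))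
    }
    where
    IsOpenΠ : Pred (Pred Πℤₚ 0ℓ) (suc 0ℓ)
    IsOpenΠ V = Lift (suc 0ℓ)
      (∀ {x} → x ∈ V → ∃[ F ] ∃[ m ] (∀ {y} → Agree F m x y → y ∈ V))

    ball-open : ∀ F m x → IsOpenΠ (Agree F m x)
    ball-open F m x = lift λ {y} ag → F , m , λ {z} ag′ → agree-trans x y z ag ag′

------------------------------------------------------------------------
-- Frobenius groups

-- P(n), the product of the prime factors of n (with multiplicity) in P.
P-part : {P : Pred ℕ 0ℓ} → Decidable P → (n : ℕ) .{{_ : NonZero n}} → ℕ
P-part P? n = product (filter P? (factors (factorise n)))

IsTopologicalGenerator : (Ω : TopologicalGroup o) → TopologicalGroup.Carrier Ω → Set (suc o)
IsTopologicalGenerator Ω ω = ∀ x → x ∈ ⟨_⟩ᶜ {G = Ω} ω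

module Frobenius
  {P : Pred ℕ 0ℓ} (P? : Decidable P)
  {G : TopologicalGroup g} {Ω : TopologicalGroup o}
  (ω : TopologicalGroup.Carrier Ω) (d : ContinuousHom G Ω)
  where

  private
    module G = TopologicalGroup G
    module Ω = TopologicalGroup Ω
  open ContinuousHom d

  infixr 8 _•_

  _•_ : ℕ → Ω.Carrier → Ω.Carrier
  _•_ = _×_ Ω.rawMonoid

  I : Subgroup G ℓ → Pred G.Carrier (o ⊔ ℓ)
  I K = ⟨ K ⟩ ∩ kernel d

  -- f[ H ∣ K ]≡ n : the index f_{H|K} is finite and equal to n.
  f[_∣_]≡_ : Subgroup G a → Subgroup G b → ℕ → Set (g ⊔ o ⊔ a ⊔ b)
  f[ H ∣ K ]≡ n = [ image d H ∶ image d K ]≡ n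

  record IsInertiallyFinite (H : Subgroup G g) : Set (suc g ⊔ o) where
    field
      closed  : IsClosed {G = G} ⟨ H ⟩
      f       : ℕ
      f-index : [ whole {G = Ω} ∶ image d H ]≡ f

  record Ω⁺ (x : Ω.Carrier) : Set o where
    field
      mult             : ℕ
      {{mult-nonZero}} : NonZero mult
      x≈mult•ω         : x Ω.≈ mult • ω

  module _ {H : Subgroup G g} (H-fin : IsInertiallyFinite H) where
    open IsInertiallyFinite H-fin

    -- d_H(h) = (1/f_H) d(h) as a relation: y is the (only, Ω being
    -- torsion-free) element of Ω with f_H y = d(h).
    d⟨_⟩≈_ : G.Carrier → Ω.Carrier → Set o
    d⟨ h ⟩≈ y = f • y Ω.≈ ⟦ h ⟧

    d⟨_⟩∈Ω⁺ : G.Carrier → Set o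
    d⟨ h ⟩∈Ω⁺ = ∃[ y ] d⟨ h ⟩≈ y ∧ Ω⁺ y

    record IsFrobeniusGroup (h : G.Carrier) (V : Subgroup G g) (S : Subgroup G g) :
                            Set (suc g ⊔ o) where
      field
        open-in : S IsOpenSubgroupOf H
        h∈S     : h ∈ ⟨ S ⟩
        d⟨h⟩    : Ω.Carrier
        d⟨h⟩-eq : d⟨ h ⟩≈ d⟨h⟩
        d⟨h⟩∈Ω⁺ : Ω⁺ d⟨h⟩
        f-eq    : f[ H ∣ S ]≡ P-part P? (Ω⁺.mult d⟨h⟩∈Ω⁺)
        I-eq    : I S ≐ I V

    -- The existence of a Frobenius group for h relative to V forces h to
    -- normalize I_V, because I_S is normal in S and h ∈ S.  For an open
    -- subgroup V that is not normal in H this is a genuine restriction: in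
    -- D₄ × ℤ₂ (d the second projection), h = (r , 1) does not normalize
    -- I_V for V = ⟨s⟩ × ℤ₂.
    frobenius⇒normalizes : ∀ {h V S} → IsFrobeniusGroup h V S → Normalizes {G = G} h (I V)
    frobenius⇒normalizes {h} {V} {S} frob x = mk⇔ conj unconj
      where
      open IsFrobeniusGroup frob
      open GroupMorphisms.IsGroupHomomorphism isHomomorphism
      module S = Subgroup S
      module GP = GroupProperties G.group

      conj-S : ∀ {y z} → y ∈ ⟨ S ⟩ → z ∈ I S → (y G.∙ z G.∙ y G.⁻¹) ∈ I S
      conj-S {y} {z} y∈S (z∈S , dz≈ε) = S.∙∈ (S.∙∈ y∈S z∈S) (S.⁻¹∈ y∈S) , (begin
        ⟦ y G.∙ z G.∙ y G.⁻¹ ⟧             ≈⟨ homo _ _ ⟩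
        ⟦ y G.∙ z ⟧ Ω.∙ ⟦ y G.⁻¹ ⟧         ≈⟨ Ω.∙-cong (homo _ _) (⁻¹-homo y) ⟩
        ⟦ y ⟧ Ω.∙ ⟦ z ⟧ Ω.∙ ⟦ y ⟧ Ω.⁻¹     ≈⟨ Ω.∙-congʳ (Ω.∙-congˡ dz≈ε) ⟩
        ⟦ y ⟧ Ω.∙ Ω.ε Ω.∙ ⟦ y ⟧ Ω.⁻¹       ≈⟨ Ω.∙-congʳ (Ω.identityʳ _) ⟩
        ⟦ y ⟧ Ω.∙ ⟦ y ⟧ Ω.⁻¹               ≈⟨ Ω.inverseʳ _ ⟩
        Ω.ε                                ∎)
        where open SetoidReasoning Ω.setoid

      conj-conj : h G.⁻¹ G.∙ (h G.∙ x G.∙ h G.⁻¹) G.∙ h G.⁻¹ G.⁻¹ G.≈ x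
      conj-conj = begin
        h G.⁻¹ G.∙ (h G.∙ x G.∙ h G.⁻¹) G.∙ h G.⁻¹ G.⁻¹   ≈⟨ G.∙-congʳ (G.∙-congˡ (G.assoc _ _ _)) ⟩
        h G.⁻¹ G.∙ (h G.∙ (x G.∙ h G.⁻¹)) G.∙ h G.⁻¹ G.⁻¹ ≈⟨ G.∙-congʳ (GP.\\-leftDividesʳ h _) ⟩
        x G.∙ h G.⁻¹ G.∙ h G.⁻¹ G.⁻¹                      ≈⟨ GP.//-rightDividesʳ (h G.⁻¹) x ⟩
        x                                                 ∎
        where open SetoidReasoning G.setoid

      conj : x ∈ I V → (h G.∙ x G.∙ h G.⁻¹) ∈ I V
      conj = proj₁ I-eq ∘ conj-S h∈S ∘ proj₂ I-eq

      unconj : (h G.∙ x G.∙ h G.⁻¹) ∈ I V → x ∈ I V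
      unconj p =
        let q₁ , q₂ = conj-S (S.⁻¹∈ h∈S) (proj₂ I-eq p)
        in proj₁ I-eq (S.resp conj-conj q₁ , Ω.trans (⟦⟧-cong (G.sym conj-conj)) q₂)

{-# OPTIONS --safe #-}
module Submission where

-- Write d(h) = eω, and choose N open normal in G with N ∩ H ⊆ V and m = [G : N].
-- By compactness d maps the closure C of ⟨h⟩ onto eΩ; as d(H) = fΩ, this gives the index of d(S)
-- for S = C · I_V.  An element c of C in the kernel of d is congruent modulo N to a power hᵏ
-- with kω ∈ mΩ; since m is a product of primes in P, m divides k, so c ∈ N by Lagrange and
-- hence c ∈ V: this is I_S = I_V.  S is open in H because the closure of ⟨hᵐ⟩ lies in V and
-- maps onto emΩ, which is open in Ω.  Any other Frobenius group S′ contains C and I_V, and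
-- the index of d(S′) forces d(S′) = d(C), whence S′ = C · I_{S′} = S.

open import Defs
open import Algebra.Bundles using (Group; AbelianGroup)
open import Algebra.Definitions using (Commutative)
open import Algebra.Definitions.RawMonoid using (_×_)
open import Algebra.Morphism.Structures using (module GroupMorphisms)
import Algebra.Properties.AbelianGroup as AbelianGroupProperties
import Algebra.Properties.CommutativeMonoid.Mult as CommutativeMonoidMult
import Algebra.Properties.Group as GroupProperties
import Algebra.Properties.Monoid.Mult as MonoidMult
open import Axiom.ExcludedMiddle using (ExcludedMiddle)
open import Data.Empty using (⊥-elim; ⊥-elim-irr)
open import Data.Fin.Base as Fin using (Fin; zero; suc; toℕ; fromℕ<)
import Data.Fin.Properties as Fin
open import Data.Integer.Base as ℤ using (ℤ; +_; 0ℤ; 1ℤ)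
import Data.Integer.Divisibility.Signed as ℤ∣
import Data.Integer.Properties as ℤ
open import Data.Integer.Tactic.RingSolver using (solve-∀)
open import Data.List.Base using ([]; _∷_; filter; map)
open import Data.List.Membership.Propositional using (find)
open import Data.List.Membership.Propositional.Properties using (∈-map⁺)
open import Data.List.Relation.Unary.All as All using (All; []; _∷_)
import Data.List.Relation.Unary.All.Properties as All
open import Data.Nat.Base as ℕ using (ℕ; zero; suc; NonZero; _≤_; _<_; _^_; _+_; _*_; _∸_; s≤s; ∣_-_∣)
open import Data.Nat.Divisibility as ℕ∣ using (_∣_; divides; _∣?_)
open import Data.Nat.DivMod using (_%_; _/_; m≡m%n+[m/n]*n; m%n<n)
open import Data.Nat.GCD using (gcd; gcd[m,n]∣m; gcd[m,n]∣n; gcd-GCD; module Bézout)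
open import Data.Nat.Induction using (<-rec)
open import Data.Nat.ListAction using (product)
open import Data.Nat.ListAction.Properties using (∈⇒∣product; product≢0)
open import Data.Nat.Primality using (Prime; prime?; prime⇒nonZero; prime⇒nonTrivial; prime⇒irreducible; euclidsLemma; productOfPrimes≢0)
open import Data.Nat.Primality.Factorisation using (PrimeFactorisation; factorise; factorisationHasAllPrimeFactors)
import Data.Nat.Properties as ℕ
open import Data.Nat.Tactic.RingSolver using () renaming (solve-∀ to ℕ-solve-∀)
open import Data.Product.Base as Product using (∃; ∃-syntax; Σ-syntax; _,_; proj₁; proj₂)
open import Data.Sum.Base using (inj₁; inj₂)
open import Data.Unit.Polymorphic.Base using (tt)
open import Function.Base using (_∘_)
open import Function.Bundles using (Inverse; Equivalence; mk⇔)
open import Level using (Level; Lift; lift; 0ℓ; _⊔_)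
open import Relation.Binary.Bundles using (Setoid)
open import Relation.Binary.Core using (Rel)
open import Relation.Binary.Definitions as Binary using (tri<; tri≈; tri>; _Respects_)
open import Relation.Binary.PropositionalEquality as ≡ using (_≡_; cong; cong₂; subst; module ≡-Reasoning)
import Relation.Binary.Reasoning.Setoid as SetoidReasoning
open import Relation.Binary.Structures using (IsEquivalence)
open import Relation.Nullary using (Dec; yes; no; ¬_; ¬?; contradiction; recompute)
open import Relation.Nullary.Decidable using (True; toWitness; fromWitness; map′; _×-dec_)
open import Relation.Unary using (Pred; Decidable; _∈_; _⊆_; _≐_; _∩_; _≬_; ⋃)

open PrimeFactorisation
open ℤₚ

-- Everything about Ω is read off from the subgroups nΩ: they are open, they intersect trivially,
-- and every class modulo nΩ contains some iω with i < n. Statements about p-adic limits thus become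
-- divisibilities of natural numbers. The obstacle is that n need not be recoverable from nΩ,
-- because a factor prime to P acts invertibly on Ω: nΩ = P(n)Ω. Hence the index of d(S) in d(H) is
-- the P-part of `mult`, and m ∣ k can be deduced from kω ∈ mΩ only for an m composed of primes in
-- P; that is where the pro-P hypothesis enters, through m = [G : N]. In G the main tool is a
-- simultaneous approximation: an element of C agrees with some power of h modulo N and, under d,
-- modulo any prescribed n. It therefore differs from that power by an element of N ∩ H ⊆ V, so that
-- the hypothesis that h normalizes I_V passes from h to all of C and makes C · I_V a subgroup.

private
  variable
    a b c g o ℓ : Level

-- Cancellation modulo powers of a prime

module _ {p : ℕ} (p-prime : Prime p) where

  private
    instance
      p≢0 : NonZero p
      p≢0 = prime⇒nonZero p-prime

  ^-cancelˡ-∤ : ∀ {a} → ¬ p ∣ a → ∀ n w → p ^ n ∣ a * w → p ^ n ∣ w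
  ^-cancelˡ-∤ p∤a zero w _ = ℕ∣.1∣ w
  ^-cancelˡ-∤ {a} p∤a (suc n) w p^∣aw
    with euclidsLemma a w p-prime (ℕ∣.∣-trans (ℕ∣.m∣m*n (p ^ n)) p^∣aw)
  ... | inj₁ p∣a = contradiction p∣a p∤a
  ... | inj₂ (divides w′ ≡.refl) =
    subst (p ^ suc n ∣_) (ℕ.*-comm p w′)
      (ℕ∣.*-monoʳ-∣ p (^-cancelˡ-∤ p∤a n w′ (ℕ∣.*-cancelˡ-∣ p (subst (p ^ suc n ∣_) eq p^∣aw))))
    where
    open ≡-Reasoning
    eq : a * (w′ * p) ≡ p * (a * w′)
    eq = begin
      a * (w′ * p)  ≡⟨ ℕ.*-assoc a w′ p ⟨
      a * w′ * p    ≡⟨ ℕ.*-comm (a * w′) p ⟩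
      p * (a * w′)  ∎

  ^∣^+ : ∀ n k → p ^ n ∣ p ^ (n + k)
  ^∣^+ n k = subst (p ^ n ∣_) (≡.sym (ℕ.^-distribˡ-+-* p n k)) (ℕ∣.m∣m*n (p ^ k))

  -- The valuation of `a` at `p` never exceeds `a`, so `k` surplus factors `p` are enough to cancel
  -- `a`. Each factor `p` split off from `a` spends one of them and makes `a` strictly smaller; `k`
  -- is therefore also the recursion measure, and no valuation has to be computed.
  ^-cancelˡ : ∀ k n a .{{_ : NonZero a}} w → a ≤ k → p ^ (n + k) ∣ a * w → p ^ n ∣ w
  ^-cancelˡ zero    n (suc _) w () _
  ^-cancelˡ (suc k) n a w a≤1+k p^∣aw with p ℕ∣.∣? a
  ... | no p∤a = ℕ∣.∣-trans (^∣^+ n (suc k)) (^-cancelˡ-∤ p∤a (n + suc k) w p^∣aw)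
  ... | yes (divides q ≡.refl) =
    ^-cancelˡ k n q {{q≢0}} w (ℕ.≤-pred (ℕ.≤-trans q<q*p a≤1+k)) (ℕ∣.*-cancelˡ-∣ p p*p^∣pqw)
    where
    instance
      q≢0 : NonZero q
      q≢0 = ℕ.m*n≢0⇒m≢0 q
    q<q*p : q < q * p
    q<q*p = ℕ.m<m*n q p (ℕ.nonTrivial⇒n>1 p {{prime⇒nonTrivial p-prime}})
    eq : ∀ q p w → q * p * w ≡ p * (q * w)
    eq = ℕ-solve-∀
    p*p^∣pqw : p * p ^ (n + k) ∣ p * (q * w)
    p*p^∣pqw = ≡.subst₂ _∣_ (cong (p ^_) (ℕ.+-suc n k)) (eq q p w) p^∣aw

  -- g divides both a and pⁿ, so pⁿ⁺ᵉ divides a · (pⁿ⁺ᵉ / g).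
  common-divisor∣^ : ∀ {a g} n e → (∀ w → p ^ (n + e) ∣ a * w → p ^ n ∣ w) →
                     g ∣ a → g ∣ p ^ n → g ∣ p ^ e
  common-divisor∣^ {g = g} n e cancel (divides a′ ≡.refl) (divides q p^n≡q*g) =
    ℕ∣.*-cancelˡ-∣ q (subst (_∣ q * p ^ e) p^n≡q*g (cancel (q * p ^ e) (divides a′ eq)))
    where
    instance
      p^n≢0 : NonZero (p ^ n)
      p^n≢0 = ℕ.m^n≢0 p n
      q*g≢0 : NonZero (q * g)
      q*g≢0 = subst NonZero p^n≡q*g p^n≢0
      q≢0 : NonZero q
      q≢0 = ℕ.m*n≢0⇒m≢0 q
    shuffle : ∀ a g q r → a * g * (q * r) ≡ a * (q * g * r)
    shuffle = ℕ-solve-∀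
    open ≡-Reasoning
    eq : a′ * g * (q * p ^ e) ≡ a′ * p ^ (n + e)
    eq = begin
      a′ * g * (q * p ^ e)    ≡⟨ shuffle a′ g q (p ^ e) ⟩
      a′ * (q * g * p ^ e)    ≡⟨ cong (λ r → a′ * (r * p ^ e)) p^n≡q*g ⟨
      a′ * (p ^ n * p ^ e)    ≡⟨ cong (a′ *_) (ℕ.^-distribˡ-+-* p n e) ⟨
      a′ * p ^ (n + e)        ∎

  -- The bound is uniform in `n`: this is why divisibility by `a` at the prime `p` is already
  -- decided by the digits up to `a`.
  gcd[a,p^n]∣p^a : ∀ a .{{_ : NonZero a}} n → gcd a (p ^ n) ∣ p ^ a
  gcd[a,p^n]∣p^a a n = common-divisor∣^ n a (λ w → ^-cancelˡ a n a w ℕ.≤-refl)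
    (gcd[m,n]∣m a (p ^ n)) (gcd[m,n]∣n a (p ^ n))

  gcd[a,p^n]∣1 : ∀ {a} → ¬ p ∣ a → ∀ n → gcd a (p ^ n) ∣ 1
  gcd[a,p^n]∣1 {a} p∤a n = common-divisor∣^ n 0
    (λ w → ^-cancelˡ-∤ p∤a n w ∘ subst (λ k → p ^ k ∣ a * w) (ℕ.+-identityʳ n))
    (gcd[m,n]∣m a (p ^ n)) (gcd[m,n]∣n a (p ^ n))

  ℤ-^-cancelˡ : ∀ n a .{{_ : NonZero a}} w → + (p ^ (n + a)) ℤ∣.∣ + a ℤ.* w → + (p ^ n) ℤ∣.∣ w
  ℤ-^-cancelˡ n a w p^∣aw = ℤ∣.∣ᵤ⇒∣
    (^-cancelˡ a n a ℤ.∣ w ∣ ℕ.≤-refl (subst (p ^ (n + a) ∣_) (ℤ.abs-* (+ a) w) (ℤ∣.∣⇒∣ᵤ p^∣aw)))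

-- Bézout's identity over ℤ and linear congruences

private
  add-subtract : ∀ d y n → d ≡ d ℤ.+ y ℤ.* n ℤ.+ (ℤ.- y) ℤ.* n
  add-subtract = solve-∀

  pos-identity : ∀ {d} y n x m → d + y * n ≡ x * m → + d ℤ.+ + y ℤ.* + n ≡ + x ℤ.* + m
  pos-identity y n x m eq rewrite ≡.sym (ℤ.pos-* y n) | ≡.sym (ℤ.pos-* x m) = cong +_ eq

bézout : ∀ m n → ∃[ s ] ∃[ t ] + gcd m n ≡ s ℤ.* + m ℤ.+ t ℤ.* + n
bézout m n with Bézout.identity (gcd-GCD m n)
... | Bézout.+- x y eq = + x , ℤ.- + y , (begin
  + gcd m n                                               ≡⟨ add-subtract (+ gcd m n) (+ y) (+ n) ⟩
  + gcd m n ℤ.+ + y ℤ.* + n ℤ.+ (ℤ.- + y) ℤ.* + n         ≡⟨ cong (λ i → i ℤ.+ (ℤ.- + y) ℤ.* + n) (pos-identity y n x m eq) ⟩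
  + x ℤ.* + m ℤ.+ (ℤ.- + y) ℤ.* + n                       ∎)
  where open ≡-Reasoning
... | Bézout.-+ x y eq = ℤ.- + x , + y , (begin
  + gcd m n                                               ≡⟨ add-subtract (+ gcd m n) (+ x) (+ m) ⟩
  + gcd m n ℤ.+ + x ℤ.* + m ℤ.+ (ℤ.- + x) ℤ.* + m         ≡⟨ cong (λ i → i ℤ.+ (ℤ.- + x) ℤ.* + m) (pos-identity x m y n eq) ⟩
  + y ℤ.* + n ℤ.+ (ℤ.- + x) ℤ.* + m                       ≡⟨ ℤ.+-comm (+ y ℤ.* + n) _ ⟩
  (ℤ.- + x) ℤ.* + m ℤ.+ + y ℤ.* + n                       ∎)
  where open ≡-Reasoning

module _ {m : ℕ} where

  mod-refl : ∀ {i} → i ≡ i [mod m ]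
  mod-refl {i} = mod (subst (+ m ℤ∣.∣_) (≡.sym (ℤ.+-inverseʳ i)) (ℤ∣.divides 0ℤ ≡.refl))

  mod-sym : ∀ {i j} → i ≡ j [mod m ] → j ≡ i [mod m ]
  mod-sym {i} {j} (mod m∣) = mod (subst (+ m ℤ∣.∣_) (eq i j) (ℤ∣.∣m⇒∣-m m∣))
    where
    eq : ∀ i j → ℤ.- (i ℤ.- j) ≡ j ℤ.- i
    eq = solve-∀

  mod-trans : ∀ {i j k} → i ≡ j [mod m ] → j ≡ k [mod m ] → i ≡ k [mod m ]
  mod-trans {i} {j} {k} (mod p) (mod q) = mod (subst (+ m ℤ∣.∣_) (eq i j k) (ℤ∣.∣m∣n⇒∣m+n p q))
    where
    eq : ∀ i j k → (i ℤ.- j) ℤ.+ (j ℤ.- k) ≡ i ℤ.- k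
    eq = solve-∀

  mod-weaken : ∀ {n i j} → m ∣ n → i ≡ j [mod n ] → i ≡ j [mod m ]
  mod-weaken m∣n (mod n∣) = mod (ℤ∣.∣-trans (ℤ∣.∣ᵤ⇒∣ m∣n) n∣)

  mod-reflexive : ∀ {i j} → i ≡ j → i ≡ j [mod m ]
  mod-reflexive ≡.refl = mod-refl

≡0⇒∣ : ∀ {i m} → i ≡ 0ℤ [mod m ] → + m ℤ∣.∣ i
≡0⇒∣ {i} {m} (mod m∣) = subst (+ m ℤ∣.∣_) (ℤ.+-identityʳ i) m∣

∣⇒≡0 : ∀ {i m} → + m ℤ∣.∣ i → i ≡ 0ℤ [mod m ]
∣⇒≡0 {i} {m} m∣ = mod (subst (+ m ℤ∣.∣_) (≡.sym (ℤ.+-identityʳ i)) m∣)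

solve-congruence : ∀ a m i → + gcd a m ℤ∣.∣ i → ∃[ y ] + a ℤ.* y ≡ i [mod m ]
solve-congruence a m i (ℤ∣.divides q i≡q*g) with s , t , g≡ ← bézout a m =
  s ℤ.* q , mod (ℤ∣.divides (ℤ.- (t ℤ.* q)) eq)
  where
  aux : ∀ a m s t q → a ℤ.* (s ℤ.* q) ℤ.- q ℤ.* (s ℤ.* a ℤ.+ t ℤ.* m) ≡ (ℤ.- (t ℤ.* q)) ℤ.* m
  aux = solve-∀
  open ≡-Reasoning
  eq : + a ℤ.* (s ℤ.* q) ℤ.- i ≡ (ℤ.- (t ℤ.* q)) ℤ.* + m
  eq = begin
    + a ℤ.* (s ℤ.* q) ℤ.- i                                ≡⟨ cong (λ j → + a ℤ.* (s ℤ.* q) ℤ.- j) i≡q*g ⟩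
    + a ℤ.* (s ℤ.* q) ℤ.- q ℤ.* + gcd a m                  ≡⟨ cong (λ j → + a ℤ.* (s ℤ.* q) ℤ.- q ℤ.* j) g≡ ⟩
    + a ℤ.* (s ℤ.* q) ℤ.- q ℤ.* (s ℤ.* + a ℤ.+ t ℤ.* + m)  ≡⟨ aux (+ a) (+ m) s t q ⟩
    (ℤ.- (t ℤ.* q)) ℤ.* + m                                ∎

-- Division in ℤ_p

module _ {p : ℕ} (p-prime : Prime p) where

  coherent⁺ : ∀ (x : ℤₚ p) n k → residue x (n + k) ≡ residue x n [mod p ^ n ]
  coherent⁺ x n zero    = mod-reflexive (cong (residue x) (ℕ.+-identityʳ n))
  coherent⁺ x n (suc k) = subst (λ l → residue x l ≡ residue x n [mod p ^ n ]) (≡.sym (ℕ.+-suc n k))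
    (mod-trans (mod-weaken (^∣^+ p-prime n k) (coherent x (n + k))) (coherent⁺ x n k))

  mod-cancel : ∀ a .{{_ : NonZero a}} n {i j} → + a ℤ.* i ≡ + a ℤ.* j [mod p ^ (n + a) ] →
               i ≡ j [mod p ^ n ]
  mod-cancel a n {i} {j} (mod p^∣) =
    mod (ℤ-^-cancelˡ p-prime n a (i ℤ.- j) (subst (+ (p ^ (n + a)) ℤ∣.∣_) (eq (+ a) i j) p^∣))
    where
    eq : ∀ a i j → a ℤ.* i ℤ.- a ℤ.* j ≡ a ℤ.* (i ℤ.- j)
    eq = solve-∀

  -- Dividing by a costs a digits of precision.
  ℤₚ-divide : ∀ a .{{_ : NonZero a}} (x : ℤₚ p) → (∀ n → + gcd a (p ^ n) ℤ∣.∣ residue x n) →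
              ∃[ y ] (∀ n → + a ℤ.* residue {p} y n ≡ residue x n [mod p ^ n ])
  ℤₚ-divide a x g∣x = y , λ n →
    mod-trans (mod-weaken (^∣^+ p-prime n a) (proj₂ (solution n))) (coherent⁺ x n a)
    where
    -- The solutions modulo p^(n + a) are chosen separately for each `n`. By `mod-cancel` they are
    -- unique modulo p^n, which is exactly what coherence asks for.
    solution : ∀ n → ∃[ y ] + a ℤ.* y ≡ residue x (n + a) [mod p ^ (n + a) ]
    solution n = solve-congruence a (p ^ (n + a)) (residue x (n + a)) (g∣x (n + a))
    y : ℤₚ p
    y = record
      { residue  = λ n → proj₁ (solution n)
      ; coherent = λ n → mod-cancel a n
          (mod-trans (mod-weaken (ℕ∣.n∣m*n p) (proj₂ (solution (suc n))))
          (mod-trans (coherent x (n + a)) (mod-sym (proj₂ (solution n)))))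
      }

-- The group ℤ_P

module ℤP (P : Pred ℕ 0ℓ) (P⊆Prime : P ⊆ Prime) where

  module Z = TopologicalGroup (ℤ[ P ])

  infixr 8 _•_

  _•_ : ℕ → Πℤₚ P → Πℤₚ P
  _•_ = _×_ Z.rawMonoid

  -- Components of an element of ℤ_P only see an irrelevant proof of p ∈ P; primality is decidable
  -- and can be recomputed from it.
  P-prime : ∀ {p} → .(p ∈ P) → Prime p
  P-prime {p} p∈P = recompute (prime? p) (P⊆Prime p∈P)

  residue-• : ∀ a x p .(p∈P : p ∈ P) n → residue ((a • x) p p∈P) n ≡ + a ℤ.* residue (x p p∈P) n
  residue-• zero    x p p∈P n = ≡.sym (ℤ.*-zeroˡ (residue (x p p∈P) n))
  residue-• (suc a) x p p∈P n = begin
    xₙ ℤ.+ residue ((a • x) p p∈P) n  ≡⟨ cong (λ j → xₙ ℤ.+ j) (residue-• a x p p∈P n) ⟩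
    xₙ ℤ.+ + a ℤ.* xₙ                 ≡⟨ aux (+ a) xₙ ⟩
    + suc a ℤ.* xₙ                    ∎
    where
    open ≡-Reasoning
    xₙ : ℤ
    xₙ = residue (x p p∈P) n
    aux : ∀ a x → x ℤ.+ a ℤ.* x ≡ (1ℤ ℤ.+ a) ℤ.* x
    aux = solve-∀

  divide : ∀ a .{{_ : NonZero a}} x →
           (∀ p .(p∈P : p ∈ P) n → + gcd a (p ^ n) ℤ∣.∣ residue (x p p∈P) n) →
           ∃[ y ] x Z.≈ a • y
  divide a x g∣x = (λ p p∈P → proj₁ (quotient p p∈P)) , λ p p∈P n →
    mod-trans (mod-sym (proj₂ (quotient p p∈P) n))
      (mod-reflexive (≡.sym (residue-• a (λ p p∈P → proj₁ (quotient p p∈P)) p p∈P n)))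
    where
    quotient : ∀ p .(p∈P : p ∈ P) →
               ∃[ y ] (∀ n → + a ℤ.* residue {p} y n ≡ residue (x p p∈P) n [mod p ^ n ])
    quotient p p∈P = ℤₚ-divide (P-prime p∈P) a (x p p∈P) (g∣x p p∈P)

  -- The equation is read at n + a, so that cancelling `a` still leaves it valid modulo p^n.
  torsion-free : ∀ a .{{_ : NonZero a}} x → a • x Z.≈ Z.ε → x Z.≈ Z.ε
  torsion-free a x ax≈0 p p∈P n = mod-trans (mod-sym (coherent⁺ (P-prime p∈P) (x p p∈P) n a))
    (mod-cancel (P-prime p∈P) a n (mod-trans
      (mod-reflexive (≡.sym (residue-• a x p p∈P (n + a))))
      (mod-trans (ax≈0 p p∈P (n + a)) (mod-reflexive (≡.sym (ℤ.*-zeroʳ (+ a)))))))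

  -- Primes above `a` do not divide `a` and impose no condition, whence the bound `suc a` on the
  -- primes. For the others gcd(a, p^n) divides p^a, whence the precision `a`.
  ball⇒multiple : ∀ a .{{_ : NonZero a}} x → Agree P (suc a) a x Z.ε → ∃[ y ] x Z.≈ a • y
  ball⇒multiple a x ball = divide a x g∣x
    where
    g∣x : ∀ p .(p∈P : p ∈ P) n → + gcd a (p ^ n) ℤ∣.∣ residue (x p p∈P) n
    g∣x p p∈P n with p ℕ.≤? a
    ... | no p≰a = ℤ∣.∣-trans
      (ℤ∣.∣ᵤ⇒∣ (gcd[a,p^n]∣1 (P-prime p∈P) (λ p∣a → p≰a (ℕ∣.∣⇒≤ p∣a)) n))
      (ℤ∣.divides (residue (x p p∈P) n) (≡.sym (ℤ.*-identityʳ _)))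
    ... | yes p≤a with ℕ.≤-total n a
    ...   | inj₁ n≤a = ℤ∣.∣-trans (ℤ∣.∣ᵤ⇒∣ (gcd[m,n]∣n a (p ^ n))) (≡0⇒∣ (ball p p∈P (s≤s p≤a) n n≤a))
    ...   | inj₂ a≤n = ℤ∣.∣-trans (ℤ∣.∣ᵤ⇒∣ (gcd[a,p^n]∣p^a (P-prime p∈P) a n)) (≡0⇒∣
      (mod-trans
        (subst (λ k → residue (x p p∈P) k ≡ residue (x p p∈P) a [mod p ^ a ]) (ℕ.m+[n∸m]≡n a≤n)
          (coherent⁺ (P-prime p∈P) (x p p∈P) a (n ℕ.∸ a)))
        (ball p p∈P (s≤s p≤a) a ℕ.≤-refl)))

  prime-to-P⇒multiple : ∀ q .{{_ : NonZero q}} → (∀ {p} → p ∈ P → ¬ p ∣ q) → ∀ x → ∃[ y ] x Z.≈ q • y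
  prime-to-P⇒multiple q P∤q x = divide q x λ p p∈P n → ℤ∣.∣-trans
    (ℤ∣.∣ᵤ⇒∣ (gcd[a,p^n]∣1 (P-prime p∈P) (λ p∣q → ⊥-elim-irr (P∤q p∈P p∣q)) n))
    (ℤ∣.divides (residue (x p p∈P) n) (≡.sym (ℤ.*-identityʳ _)))

  infinitely-divisible⇒0 : ∀ x → (∀ a .{{_ : NonZero a}} → ∃[ y ] x Z.≈ a • y) → x Z.≈ Z.ε
  infinitely-divisible⇒0 x div p p∈P n
    with y , x≈ ← div (p ^ n) {{ℕ.m^n≢0 p n {{prime⇒nonZero (P-prime p∈P)}}}} =
    mod-trans (x≈ p p∈P n) (mod-trans (mod-reflexive (residue-• (p ^ n) y p p∈P n))
      (∣⇒≡0 (ℤ∣.divides (residue (y p p∈P) n) (ℤ.*-comm (+ (p ^ n)) _))))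

  -- The element with all residues 1 is a witness. That pΩ is not all of Ω is the contradiction from
  -- which divisibility by `p` is later recovered.
  not-divisible : ∀ {p} → p ∈ P → ∃[ x ] ¬ (∃[ y ] x Z.≈ p • y)
  not-divisible {p} p∈P = one , λ (y , 1≈py) →
    let p∣p•y = subst (λ q → + q ℤ∣.∣ + p ℤ.* residue (y p p∈P) 1) (≡.sym (ℕ.^-identityʳ p))
                  (ℤ∣.divides (residue (y p p∈P) 1) (ℤ.*-comm (+ p) _))
        1≡0 = mod-trans (1≈py p p∈P 1) (mod-trans (mod-reflexive (residue-• p y p p∈P 1)) (∣⇒≡0 p∣p•y))
        p∣1 = subst (_∣ 1) (ℕ.^-identityʳ p) (ℤ∣.∣⇒∣ᵤ (≡0⇒∣ 1≡0))
    in ℕ.<⇒≱ (ℕ.nonTrivial⇒n>1 p {{prime⇒nonTrivial (P-prime p∈P)}}) (ℕ∣.∣⇒≤ p∣1)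
    where
    one : Πℤₚ P
    one _ _ = record { residue = λ _ → 1ℤ ; coherent = λ _ → mod-refl }

  ball-open : ∀ F m x → Z.IsOpen (Agree P F m x)
  ball-open F m x = lift λ near → F , m , λ near′ p p∈P p<F n n≤m →
    mod-trans (near p p∈P p<F n n≤m) (near′ p p∈P p<F n n≤m)

  near⇒multiple : ∀ a .{{_ : NonZero a}} x y → Agree P (suc a) a x y → ∃[ z ] y Z.≈ x Z.∙ a • z
  near⇒multiple a x y near =
    let z , eq = ball⇒multiple a (x Z.⁻¹ Z.∙ y) (λ p p∈P p<F n n≤a →
                   difference (residue (x p p∈P) n) (residue (y p p∈P) n) (near p p∈P p<F n n≤a))
    in z , Z.trans {y} {x Z.∙ (x Z.⁻¹ Z.∙ y)} {x Z.∙ a • z}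
             (Z.sym {x Z.∙ (x Z.⁻¹ Z.∙ y)} {y} (GroupProperties.\\-leftDividesˡ Z.group x y))
             (Z.∙-congˡ {x} {x Z.⁻¹ Z.∙ y} {a • z} eq)
    where
    difference : ∀ {m} i j → i ≡ j [mod m ] → ℤ.- i ℤ.+ j ≡ 0ℤ [mod m ]
    difference {m} i j (mod m∣) = mod (subst (+ m ℤ∣.∣_) (eq i j) (ℤ∣.∣m⇒∣-m m∣))
      where
      eq : ∀ i j → ℤ.- (i ℤ.- j) ≡ ℤ.- i ℤ.+ j ℤ.- 0ℤ
      eq = solve-∀

-- Lagrange's theorem

least : {Q : Pred ℕ ℓ} → Decidable Q → ∀ n → Q n → ∃[ r ] Q r ∧ (∀ {m} → m < r → ¬ Q m)
least {Q = Q} Q? = <-rec _ step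
  where
  step : ∀ n → (∀ {m} → m < n → Q m → ∃[ r ] Q r ∧ (∀ {m} → m < r → ¬ Q m)) →
         Q n → ∃[ r ] Q r ∧ (∀ {m} → m < r → ¬ Q m)
  step n rec Qn with ℕ.anyUpTo? Q? n
  ... | yes (m , m<n , Qm) = rec m<n Qm
  ... | no none            = n , Qn , λ m<n Qm → none (_ , m<n , Qm)

-- A numbered transversal, with which cosets are counted without forming a quotient.
record Classes {n} (R : Rel (Fin n) ℓ) : Set ℓ where
  field
    size          : ℕ
    rep           : Fin size → Fin n
    class         : Fin n → Fin size
    rep-class     : ∀ i → R (rep (class i)) i
    rep-injective : ∀ {j k} → R (rep j) (rep k) → j ≡ k

classes : ∀ n {R : Rel (Fin n) ℓ} → IsEquivalence R → Binary.Decidable R → Classes R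
classes zero    _   _  = record
  { size = 0 ; rep = λ () ; class = λ () ; rep-class = λ () ; rep-injective = λ {j} → contradiction j Fin.¬Fin0 }
classes (suc n) {R} equiv R? = extend (Fin.any? (λ j → R? (suc (rep j)) zero))
  where
  open IsEquivalence equiv
  rest : Classes (λ i j → R (suc i) (suc j))
  rest = classes n (record { refl = refl ; sym = sym ; trans = trans }) (λ i j → R? (suc i) (suc j))
  open Classes rest
  extend : Dec (∃[ j ] R (suc (rep j)) zero) → Classes R
  extend (yes (j , Rj0)) = record
    { size          = size
    ; rep           = suc ∘ rep
    ; class         = λ { zero → j ; (suc i) → class i }
    ; rep-class     = λ { zero → Rj0 ; (suc i) → rep-class i }
    ; rep-injective = rep-injective
    }
  extend (no none) = record
    { size          = suc size
    ; rep           = λ { zero → zero ; (suc j) → suc (rep j) }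
    ; class         = λ { zero → zero ; (suc i) → suc (class i) }
    ; rep-class     = λ { zero → refl ; (suc i) → rep-class i }
    ; rep-injective = λ
      { {zero}  {zero}  _ → ≡.refl
      ; {zero}  {suc k} r → contradiction (k , sym r) none
      ; {suc j} {zero}  r → contradiction (j , r) none
      ; {suc j} {suc k} r → cong suc (rep-injective r)
      }
    }

module _ (Q : Group c ℓ) where
  open Group Q
  open GroupProperties Q
  open MonoidMult monoid using (×-homo-+; ×-assocˡ; ×-congˡ; ×-congʳ)
  open SetoidReasoning setoid

  private
    infixr 8 _•_
    _•_ : ℕ → Carrier → Carrier
    _•_ = _×_ rawMonoid

  •-∸ : ∀ h {i j} → i ≤ j → i • h ∙ (j ∸ i) • h ≈ j • h
  •-∸ h {i} {j} i≤j = begin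
    i • h ∙ (j ∸ i) • h  ≈⟨ ×-homo-+ h i (j ∸ i) ⟨
    (i + (j ∸ i)) • h    ≈⟨ ×-congˡ (ℕ.m+[n∸m]≡n i≤j) ⟩
    j • h                ∎

  •-equal : ∀ h {i j} → i ≤ j → i • h ≈ j • h → (j ∸ i) • h ≈ ε
  •-equal h {i} {j} i≤j eq = ∙-cancelˡ (i • h) _ _ (begin
    i • h ∙ (j ∸ i) • h  ≈⟨ •-∸ h i≤j ⟩
    j • h                ≈⟨ eq ⟨
    i • h                ≈⟨ identityʳ _ ⟨
    i • h ∙ ε            ∎)

  •-ε : ∀ n → n • ε ≈ ε
  •-ε zero    = Group.refl Q
  •-ε (suc n) = begin
    ε ∙ n • ε  ≈⟨ identityˡ _ ⟩
    n • ε      ≈⟨ •-ε n ⟩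
    ε          ∎

  •-multiple : ∀ h k {n} → n • h ≈ ε → (k * n) • h ≈ ε
  •-multiple h k {n} nh≈ε = begin
    (k * n) • h  ≈⟨ ×-assocˡ h k n ⟨
    k • n • h    ≈⟨ ×-congʳ k nh≈ε ⟩
    k • ε        ≈⟨ •-ε k ⟩
    ε            ∎

  •-% : ∀ h k r .{{_ : NonZero r}} → r • h ≈ ε → (k % r) • h ≈ k • h
  •-% h k r rh≈ε = begin
    (k % r) • h                      ≈⟨ identityʳ _ ⟨
    (k % r) • h ∙ ε                  ≈⟨ ∙-congˡ (•-multiple h (k / r) rh≈ε) ⟨
    (k % r) • h ∙ ((k / r) * r) • h  ≈⟨ ×-homo-+ h (k % r) (k / r * r) ⟨
    (k % r + k / r * r) • h          ≈⟨ ×-congˡ (m≡m%n+[m/n]*n k r) ⟨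
    k • h                            ∎

  module _ {n} (enum : Inverse (≡.setoid (Fin n)) setoid) where
    private
      u : Fin n → Carrier
      u = Inverse.to enum

      index : Carrier → Fin n
      index = Inverse.from enum

      u-index : ∀ x → u (index x) ≈ x
      u-index = Inverse.strictlyInverseˡ enum

      index-injective : ∀ {x y} → index x ≡ index y → x ≈ y
      index-injective {x} {y} eq = begin
        x            ≈⟨ u-index x ⟨
        u (index x)  ≡⟨ cong u eq ⟩
        u (index y)  ≈⟨ u-index y ⟩
        y            ∎

      u-injective : ∀ {i j} → u i ≈ u j → i ≡ j
      u-injective {i} {j} eq = ≡.trans (≡.sym (Inverse.strictlyInverseʳ enum i))
        (≡.trans (Inverse.from-cong enum eq) (Inverse.strictlyInverseʳ enum j))

      _≟_ : ∀ x y → Dec (x ≈ y)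
      x ≟ y = map′ index-injective (Inverse.from-cong enum) (index x Fin.≟ index y)

    finite-order : ∀ h → ∃[ r ] NonZero r ∧ r • h ≈ ε ∧
                   (∀ {i j} → i < r → j < r → i • h ≈ j • h → i ≡ j)
    -- Two of the first n + 1 powers coincide by the pigeonhole principle; the difference of their
    -- exponents starts the search for the least period.
    finite-order h with i , j , i<j , eq ← Fin.pigeonhole (ℕ.n<1+n n) (λ i → index (toℕ i • h))
      with r , (r>0 , rh≈ε) , minimal ← least (λ k → (0 ℕ.<? k) ×-dec ((k • h) ≟ ε)) (toℕ j ∸ toℕ i)
             (ℕ.m<n⇒0<n∸m i<j , •-equal h (ℕ.<⇒≤ i<j) (index-injective eq))
      = r , ℕ.>-nonZero r>0 , rh≈ε , injective
      where
      no-smaller : ∀ {i j} → i < j → j < r → ¬ i • h ≈ j • h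
      no-smaller {i} {j} i<j j<r eq = minimal (ℕ.≤-<-trans (ℕ.m∸n≤m j i) j<r)
        (ℕ.m<n⇒0<n∸m i<j , •-equal h (ℕ.<⇒≤ i<j) eq)
      injective : ∀ {i j} → i < r → j < r → i • h ≈ j • h → i ≡ j
      injective {i} {j} i<r j<r eq with ℕ.<-cmp i j
      ... | tri< i<j _ _ = contradiction eq (no-smaller i<j j<r)
      ... | tri≈ _ i≡j _ = i≡j
      ... | tri> _ _ j<i = contradiction (sym eq) (no-smaller j<i i<r)

    -- The left cosets of the powers of `h` all have `r` elements, so n = size * r is a multiple of
    -- the order `r`. The equality comes from two injections: `ψ` decomposes an element into a
    -- representative and a power of `h`, `φ` multiplies them together.
    lagrange : ∀ h → n • h ≈ ε
    lagrange h with r , r≢0 , rh≈ε , distinct ← finite-order h = begin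
      n • h           ≡⟨ cong (_• h) (ℕ.≤-antisym (Fin.injective⇒≤ ψ-injective) (Fin.injective⇒≤ φ-injective)) ⟩
      (size * r) • h  ≈⟨ •-multiple h size rh≈ε ⟩
      ε               ∎
      where
      instance
        _ : NonZero r
        _ = r≢0

      R : Rel (Fin n) ℓ
      R i j = ∃[ k ] u i ∙ k • h ≈ u j

      R-sym : ∀ {i j} → R i j → R j i
      -- Exponents are natural numbers, so the inverse of k • h is taken as k (r - 1) • h.
      R-sym {i} {j} (k , eq) = k * ℕ.pred r , (begin
        u j ∙ (k * ℕ.pred r) • h            ≈⟨ ∙-congʳ eq ⟨
        u i ∙ k • h ∙ (k * ℕ.pred r) • h    ≈⟨ assoc _ _ _ ⟩
        u i ∙ (k • h ∙ (k * ℕ.pred r) • h)  ≈⟨ ∙-congˡ (×-homo-+ h k (k * ℕ.pred r)) ⟨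
        u i ∙ (k + k * ℕ.pred r) • h        ≡⟨ cong (λ l → u i ∙ l • h) (ℕ.*-suc k (ℕ.pred r)) ⟨
        u i ∙ (k * suc (ℕ.pred r)) • h      ≡⟨ cong (λ l → u i ∙ (k * l) • h) (ℕ.suc-pred r) ⟩
        u i ∙ (k * r) • h                   ≈⟨ ∙-congˡ (•-multiple h k rh≈ε) ⟩
        u i ∙ ε                             ≈⟨ identityʳ _ ⟩
        u i                                 ∎)

      R-trans : ∀ {i j k} → R i j → R j k → R i k
      R-trans {i} {j} {k} (a , p) (b , q) = a + b , (begin
        u i ∙ (a + b) • h      ≈⟨ ∙-congˡ (×-homo-+ h a b) ⟩
        u i ∙ (a • h ∙ b • h)  ≈⟨ assoc _ _ _ ⟨
        u i ∙ a • h ∙ b • h    ≈⟨ ∙-congʳ p ⟩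
        u j ∙ b • h            ≈⟨ q ⟩
        u k                    ∎)

      R? : Binary.Decidable R
      R? i j = map′ (λ (e , eq) → toℕ e , eq) (λ (k , eq) → fromℕ< (m%n<n k r) , (begin
        u i ∙ toℕ (fromℕ< (m%n<n k r)) • h  ≡⟨ cong (λ l → u i ∙ l • h) (Fin.toℕ-fromℕ< (m%n<n k r)) ⟩
        u i ∙ (k % r) • h                   ≈⟨ ∙-congˡ (•-% h k r rh≈ε) ⟩
        u i ∙ k • h                         ≈⟨ eq ⟩
        u j                                 ∎))
        (Fin.any? {n = r} (λ e → (u i ∙ toℕ e • h) ≟ u j))

      R-classes : Classes R
      R-classes = classes n (record { refl = 0 , identityʳ _ ; sym = R-sym ; trans = R-trans }) R?

      open Classes R-classes

      exponent : ∀ i → ∃[ e ] u (rep (class i)) ∙ toℕ {r} e • h ≈ u i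
      exponent i with k , eq ← rep-class i = fromℕ< (m%n<n k r) , (begin
        u (rep (class i)) ∙ toℕ (fromℕ< (m%n<n k r)) • h  ≡⟨ cong (λ l → u (rep (class i)) ∙ l • h) (Fin.toℕ-fromℕ< (m%n<n k r)) ⟩
        u (rep (class i)) ∙ (k % r) • h                   ≈⟨ ∙-congˡ (•-% h k r rh≈ε) ⟩
        u (rep (class i)) ∙ k • h                         ≈⟨ eq ⟩
        u i                                               ∎)

      ψ : Fin n → Fin (size * r)
      ψ i = Fin.combine (class i) (proj₁ (exponent i))

      ψ-injective : ∀ {i j} → ψ i ≡ ψ j → i ≡ j
      ψ-injective {i} {j} eq with p , q ← Fin.combine-injective _ _ _ _ eq = u-injective (begin
        u i                                                ≈⟨ proj₂ (exponent i) ⟨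
        u (rep (class i)) ∙ toℕ (proj₁ (exponent i)) • h   ≡⟨ cong₂ (λ c e → u (rep c) ∙ toℕ e • h) p q ⟩
        u (rep (class j)) ∙ toℕ (proj₁ (exponent j)) • h   ≈⟨ proj₂ (exponent j) ⟩
        u j                                                ∎)

      φ′ : Fin size → Fin r → Carrier
      φ′ c e = u (rep c) ∙ toℕ e • h

      φ : Fin (size * r) → Fin n
      φ = index ∘ Product.uncurry φ′ ∘ Fin.remQuot {size} r

      φ′-injective : ∀ {c c′ e e′} → φ′ c e ≈ φ′ c′ e′ → c ≡ c′ ∧ e ≡ e′
      φ′-injective {c} {c′} {e} {e′} eq = c≡c′ , Fin.toℕ-injective (distinct (Fin.toℕ<n e) (Fin.toℕ<n e′)
          (∙-cancelˡ (u (rep c)) _ _ (begin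
            u (rep c) ∙ toℕ e • h    ≈⟨ eq ⟩
            u (rep c′) ∙ toℕ e′ • h  ≡⟨ cong (λ c → u (rep c) ∙ toℕ e′ • h) c≡c′ ⟨
            u (rep c) ∙ toℕ e′ • h   ∎)))
        where
        c≡c′ : c ≡ c′
        c≡c′ = rep-injective (R-trans {j = index (φ′ c e)}
          (toℕ e , sym (u-index _)) (R-sym (toℕ e′ , trans (sym eq) (sym (u-index _)))))

      φ-injective : ∀ {x y} → φ x ≡ φ y → x ≡ y
      φ-injective {x} {y} eq with p , q ← φ′-injective (index-injective eq) =
        ≡.trans (≡.sym (Fin.combine-remQuot {size} r x))
          (≡.trans (cong₂ Fin.combine p q) (Fin.combine-remQuot {size} r y))

-- Quotients of subgroups

module _ {G : TopologicalGroup g} where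
  open TopologicalGroup G
  open GroupProperties group
  open SetoidReasoning setoid

  IsNormalIn : Subgroup G a → Subgroup G b → Set _
  IsNormalIn A B = ∀ {y x} → y ∈ ⟨ A ⟩ → x ∈ ⟨ B ⟩ → (y ∙ x ∙ y ⁻¹) ∈ ⟨ B ⟩

  module _ (A : Subgroup G a) (B : Subgroup G b) (normal : IsNormalIn A B) where
    private
      module A = Subgroup A
      module B = Subgroup B

    quotientGroup : Group _ _
    quotientGroup = record
      { Carrier = ∃ ⟨ A ⟩
      ; _≈_     = Setoid._≈_ (LeftCosets A B)
      ; _∙_     = λ (x , x∈A) (y , y∈A) → x ∙ y , A.∙∈ x∈A y∈A
      ; ε       = ε , A.ε∈
      ; _⁻¹     = λ (x , x∈A) → x ⁻¹ , A.⁻¹∈ x∈A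
      ; isGroup = record
        { isMonoid = record
          { isSemigroup = record
            { isMagma = record
              { isEquivalence = Setoid.isEquivalence (LeftCosets A B)
              ; ∙-cong = λ {(x , _)} {(y , _)} {(u , u∈A)} {(v , _)} p q → B.resp (∙-eq x y u v)
                           (B.∙∈ (normal (A.⁻¹∈ u∈A) p) q)
              }
            ; assoc = λ (x , _) (y , _) (z , _) → ≈⇒≋ (assoc x y z)
            }
          ; identity = (λ (x , _) → ≈⇒≋ (identityˡ x)) , (λ (x , _) → ≈⇒≋ (identityʳ x))
          }
        ; inverse = (λ (x , _) → ≈⇒≋ (inverseˡ x)) , (λ (x , _) → ≈⇒≋ (inverseʳ x))
        ; ⁻¹-cong = λ {(x , _)} {(y , y∈A)} p → B.resp (⁻¹-eq x y) (B.⁻¹∈ (normal y∈A p))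
        }
      }
      where
      ≈⇒≋ : ∀ {x y} → x ≈ y → (x ⁻¹ ∙ y) ∈ ⟨ B ⟩
      ≈⇒≋ {x} {y} x≈y = B.resp (trans (sym (inverseˡ x)) (∙-congˡ x≈y)) B.ε∈

      ∙-eq : ∀ x y u v → (u ⁻¹ ∙ (x ⁻¹ ∙ y) ∙ u ⁻¹ ⁻¹) ∙ (u ⁻¹ ∙ v) ≈ (x ∙ u) ⁻¹ ∙ (y ∙ v)
      ∙-eq x y u v = begin
        (u ⁻¹ ∙ (x ⁻¹ ∙ y) ∙ u ⁻¹ ⁻¹) ∙ (u ⁻¹ ∙ v)   ≈⟨ assoc _ _ _ ⟩
        u ⁻¹ ∙ (x ⁻¹ ∙ y) ∙ (u ⁻¹ ⁻¹ ∙ (u ⁻¹ ∙ v))   ≈⟨ ∙-congˡ (\\-leftDividesʳ (u ⁻¹) v) ⟩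
        u ⁻¹ ∙ (x ⁻¹ ∙ y) ∙ v                        ≈⟨ ∙-congʳ (assoc _ _ _) ⟨
        u ⁻¹ ∙ x ⁻¹ ∙ y ∙ v                          ≈⟨ assoc _ _ _ ⟩
        u ⁻¹ ∙ x ⁻¹ ∙ (y ∙ v)                        ≈⟨ ∙-congʳ (⁻¹-anti-homo-∙ x u) ⟨
        (x ∙ u) ⁻¹ ∙ (y ∙ v)                         ∎

      ⁻¹-eq : ∀ x y → (y ∙ (x ⁻¹ ∙ y) ∙ y ⁻¹) ⁻¹ ≈ x ⁻¹ ⁻¹ ∙ y ⁻¹
      ⁻¹-eq x y = begin
        (y ∙ (x ⁻¹ ∙ y) ∙ y ⁻¹) ⁻¹  ≈⟨ ⁻¹-cong (∙-congʳ (assoc _ _ _)) ⟨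
        (y ∙ x ⁻¹ ∙ y ∙ y ⁻¹) ⁻¹    ≈⟨ ⁻¹-cong (//-rightDividesʳ y (y ∙ x ⁻¹)) ⟩
        (y ∙ x ⁻¹) ⁻¹               ≈⟨ ⁻¹-anti-homo-∙ y (x ⁻¹) ⟩
        x ⁻¹ ⁻¹ ∙ y ⁻¹              ∎

    -- Lagrange's theorem in `A / B`. Triviality of a class there unfolds to (n • h) ⁻¹ ∙ ε ∈ B,
    -- hence the inverse taken in the proof.
    index-power∈ : ∀ {n} → [ A ∶ B ]≡ n → ∀ {h} → h ∈ ⟨ A ⟩ → (_×_ rawMonoid n h) ∈ ⟨ B ⟩
    index-power∈ {n} index {h} h∈A =
      B.resp (trans (⁻¹-cong (identityʳ _)) (⁻¹-involutive _))
        (B.⁻¹∈ (B.resp (∙-congʳ (⁻¹-cong (reflexive (power n))))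
          (lagrange quotientGroup index (h , h∈A))))
      where
      power : ∀ k → proj₁ (_×_ (Group.rawMonoid quotientGroup) k (h , h∈A)) ≡ _×_ rawMonoid k h
      power zero    = ≡.refl
      power (suc k) = cong (h ∙_) (power k)

-- Powers, cyclic subgroups and indices

module _ {G : TopologicalGroup g} where
  open TopologicalGroup G
  open GroupProperties group
  open MonoidMult monoid using (×-homo-+; ×-assocˡ; ×-congˡ)
  open SetoidReasoning setoid

  private
    infixr 8 _•_
    _•_ : ℕ → Carrier → Carrier
    _•_ = _×_ rawMonoid

  locally-open⇒open : {V : Pred Carrier g} →
    (∀ {x} → x ∈ V → ∃[ A ] IsOpen A ∧ x ∈ A ∧ A ⊆ V) → IsOpen V
  locally-open⇒open nbhd = open-resp-≐
    ((λ ((x , x∈V) , y∈A) → nbhd x∈V .proj₂ .proj₂ .proj₂ y∈A) ,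
     (λ {x} x∈V → (x , x∈V) , nbhd x∈V .proj₂ .proj₂ .proj₁))
    (open-⋃ (λ (x , x∈V) → nbhd x∈V .proj₂ .proj₁))

  -- Integer powers of `h` appear as quotients of natural ones, because `•` only takes natural
  -- multiples. The powers of `h` commute, which lets the `mul` case regroup the exponents.
  generated⇒power-quotient : ∀ {h x} → x ∈ Generated {G = G} h → ∃[ i ] ∃[ j ] x ∙ j • h ≈ i • h
  generated⇒power-quotient gen  = 1 , 0 , refl
  generated⇒power-quotient unit = 0 , 0 , identityʳ ε
  generated⇒power-quotient {h} (mul {x} {y} x∈ y∈)
    with i , j , p ← generated⇒power-quotient x∈ | k , l , q ← generated⇒power-quotient y∈
    = i + k , l + j , (begin
      x ∙ y ∙ (l + j) • h        ≈⟨ ∙-congˡ (×-homo-+ h l j) ⟩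
      x ∙ y ∙ (l • h ∙ j • h)    ≈⟨ assoc _ _ _ ⟩
      x ∙ (y ∙ (l • h ∙ j • h))  ≈⟨ ∙-congˡ (assoc _ _ _) ⟨
      x ∙ (y ∙ l • h ∙ j • h)    ≈⟨ ∙-congˡ (∙-congʳ q) ⟩
      x ∙ (k • h ∙ j • h)        ≈⟨ ∙-congˡ (×-homo-+ h k j) ⟨
      x ∙ (k + j) • h            ≡⟨ cong (λ n → x ∙ n • h) (ℕ.+-comm k j) ⟩
      x ∙ (j + k) • h            ≈⟨ ∙-congˡ (×-homo-+ h j k) ⟩
      x ∙ (j • h ∙ k • h)        ≈⟨ assoc _ _ _ ⟨
      x ∙ j • h ∙ k • h          ≈⟨ ∙-congʳ p ⟩
      i • h ∙ k • h              ≈⟨ ×-homo-+ h i k ⟨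
      (i + k) • h                ∎)
  generated⇒power-quotient {h} (inv {x} x∈) with i , j , p ← generated⇒power-quotient x∈ =
    j , i , (begin
      x ⁻¹ ∙ i • h        ≈⟨ ∙-congˡ p ⟨
      x ⁻¹ ∙ (x ∙ j • h)  ≈⟨ \\-leftDividesʳ x _ ⟩
      j • h               ∎)
  generated⇒power-quotient (resp x≈y x∈) with i , j , p ← generated⇒power-quotient x∈ =
    i , j , trans (∙-congʳ (sym x≈y)) p

  module _ (A : Subgroup G a) where
    open Subgroup A using (ε∈; ∙∈; ⁻¹∈) renaming (resp to A-resp)

    •∈ : ∀ n {x} → x ∈ ⟨ A ⟩ → (n • x) ∈ ⟨ A ⟩
    •∈ zero    _   = ε∈
    •∈ (suc n) x∈A = ∙∈ x∈A (•∈ n x∈A)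

    ∙-cancelʳ-∈ : ∀ {x y} → (x ∙ y) ∈ ⟨ A ⟩ → y ∈ ⟨ A ⟩ → x ∈ ⟨ A ⟩
    ∙-cancelʳ-∈ {x} {y} xy∈A y∈A = A-resp (//-rightDividesʳ y x) (∙∈ xy∈A (⁻¹∈ y∈A))

    ∙-cancelˡ-∈ : ∀ {x y} → (x ∙ y) ∈ ⟨ A ⟩ → x ∈ ⟨ A ⟩ → y ∈ ⟨ A ⟩
    ∙-cancelˡ-∈ {x} {y} xy∈A x∈A = A-resp (\\-leftDividesʳ x y) (∙∈ (⁻¹∈ x∈A) xy∈A)

    generated⊆ : ∀ {h} → h ∈ ⟨ A ⟩ → Generated {G = G} h ⊆ ⟨ A ⟩
    generated⊆ h∈A gen         = h∈A
    generated⊆ h∈A unit        = ε∈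
    generated⊆ h∈A (mul x∈ y∈) = ∙∈ (generated⊆ h∈A x∈) (generated⊆ h∈A y∈)
    generated⊆ h∈A (inv x∈)    = ⁻¹∈ (generated⊆ h∈A x∈)
    generated⊆ h∈A (resp x≈y x∈) = A-resp x≈y (generated⊆ h∈A x∈)

    -- The subtraction-free form of d = k i - l n, the shape that Bézout's identity takes over ℕ.
    •-difference∈ : ∀ {d} x i n k l → d + l * n ≡ k * i →
                    (i • x) ∈ ⟨ A ⟩ → (n • x) ∈ ⟨ A ⟩ → (d • x) ∈ ⟨ A ⟩
    •-difference∈ {d} x i n k l eq ix∈A nx∈A = ∙-cancelʳ-∈
      (A-resp (trans (×-assocˡ x k i) (trans (×-congˡ (≡.sym eq)) (×-homo-+ x d (l * n)))) (•∈ k ix∈A))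
      (A-resp (×-assocˡ x l n) (•∈ l nx∈A))

    gcd-•∈ : ∀ i n x → (i • x) ∈ ⟨ A ⟩ → (n • x) ∈ ⟨ A ⟩ → (gcd i n • x) ∈ ⟨ A ⟩
    gcd-•∈ i n x ix∈A nx∈A with Bézout.identity (gcd-GCD i n)
    ... | Bézout.+- k l eq = •-difference∈ x i n k l eq ix∈A nx∈A
    ... | Bézout.-+ k l eq = •-difference∈ x n i l k eq nx∈A ix∈A

  module _ {A : Subgroup G a} {B : Subgroup G b} where
    open Setoid (LeftCosets A B) using () renaming (_≈_ to _≋_; sym to ≋-sym; trans to ≋-trans)

    index-intro : ∀ {n} (to : Fin n → ∃ ⟨ A ⟩) (from : ∃ ⟨ A ⟩ → Fin n) →
                  (∀ x → to (from x) ≋ x) → (∀ {i j} → to i ≋ to j → i ≡ j) → [ A ∶ B ]≡ n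
    index-intro to from section injective = record
      { to        = to
      ; from      = from
      ; to-cong   = λ { {i} ≡.refl → Setoid.refl (LeftCosets A B) {to i} }
      ; from-cong = λ {x} {y} x≋y → injective (≋-trans {to (from x)} {x} {to (from y)} (section x)
                      (≋-trans {x} {y} {to (from y)} x≋y (≋-sym {to (from y)} {y} (section y))))
      ; inverse   = (λ { {x} ≡.refl → section x })
                  , (λ {i} {y} y≋ → injective (≋-trans {to (from y)} {y} {to i} (section y) y≋))
      }

    index⇒nonZero : ∀ {n} → [ A ∶ B ]≡ n → NonZero n
    index⇒nonZero index = Fin.nonZeroIndex (Inverse.from index (ε , Subgroup.ε∈ A))

  ≈-coset : ∀ {x y z} → x ≈ y ∙ z → y ⁻¹ ∙ x ≈ z
  ≈-coset {x} {y} {z} eq = trans (∙-congˡ eq) (\\-leftDividesʳ y z)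

  coset-≈ : ∀ {x y z} → y ⁻¹ ∙ x ≈ z → x ≈ y ∙ z
  coset-≈ {x} {y} {z} eq = trans (sym (\\-leftDividesˡ y x)) (∙-congˡ eq)

-- Homomorphisms and transport along isomorphisms

module _ {G : TopologicalGroup g} {K : TopologicalGroup o} (f : ContinuousHom G K) where
  private
    module G = TopologicalGroup G
    module K = TopologicalGroup K
  open ContinuousHom f
  open GroupMorphisms.IsGroupHomomorphism isHomomorphism

  •-homo : ∀ n x → ⟦ _×_ G.rawMonoid n x ⟧ K.≈ _×_ K.rawMonoid n ⟦ x ⟧
  •-homo zero    x = ε-homo
  •-homo (suc n) x = K.trans (homo x _) (K.∙-congˡ (•-homo n x))

module Transport {G : TopologicalGroup g} {K : TopologicalGroup o} (G≅K : G ≅ K) where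
  private
    module G = TopologicalGroup G
    module K = TopologicalGroup K
  open _≅_ G≅K using (to; from; inverse) public
  open ContinuousHom to public
  open GroupMorphisms.IsGroupHomomorphism isHomomorphism public

  to-from : ∀ y → ⟦ from y ⟧ K.≈ y
  to-from y = proj₁ inverse G.refl

  -- An isomorphism supplies the homomorphism law for `to` only, so equations in `G` are checked
  -- after applying `to`.
  injective : ∀ {x y} → ⟦ x ⟧ K.≈ ⟦ y ⟧ → x G.≈ y
  injective eq = G.trans (G.sym (proj₂ inverse (K.sym eq))) (proj₂ inverse K.refl)

  pull-• : ∀ {x} n {z} → ⟦ x ⟧ K.≈ _×_ K.rawMonoid n z → x G.≈ _×_ G.rawMonoid n (from z)
  pull-• {x} n {z} eq = injective (K.trans eq
    (K.sym (K.trans (•-homo to n (from z)) (MonoidMult.×-congʳ K.monoid n (to-from z)))))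

  pull-∙• : ∀ {x y} n {z} → ⟦ x ⟧ K.≈ ⟦ y ⟧ K.∙ _×_ K.rawMonoid n z →
            x G.≈ y G.∙ _×_ G.rawMonoid n (from z)
  pull-∙• {x} {y} n {z} eq = injective (K.trans eq (K.sym (K.trans (homo y _) (K.∙-congˡ
    (K.trans (•-homo to n (from z)) (MonoidMult.×-congʳ K.monoid n (to-from z)))))))

  push-• : ∀ {x} n {z} → x G.≈ _×_ G.rawMonoid n z → ⟦ x ⟧ K.≈ _×_ K.rawMonoid n ⟦ z ⟧
  push-• n {z} eq = K.trans (⟦⟧-cong eq) (•-homo to n z)

  pull-ε : ∀ {x} → ⟦ x ⟧ K.≈ K.ε → x G.≈ G.ε
  pull-ε eq = injective (K.trans eq (K.sym ε-homo))

  pull-torsion : ∀ n → (∀ y → _×_ K.rawMonoid n y K.≈ K.ε → y K.≈ K.ε) →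
                 ∀ {x} → _×_ G.rawMonoid n x G.≈ G.ε → x G.≈ G.ε
  pull-torsion n torsion-free {x} nx≈ε = pull-ε (torsion-free ⟦ x ⟧
    (K.trans (K.sym (•-homo to n x)) (K.trans (⟦⟧-cong nx≈ε) ε-homo)))

  push-divisible : ∀ n {y} → ∃[ z ] from y G.≈ _×_ G.rawMonoid n z → ∃[ z ] y K.≈ _×_ K.rawMonoid n z
  push-divisible n {y} (z , eq) = ⟦ z ⟧ , K.trans (K.sym (to-from y)) (push-• n eq)

  pull-comm : Commutative K._≈_ K._∙_ → Commutative G._≈_ G._∙_
  pull-comm comm x y = injective (K.trans (homo x y) (K.trans (comm ⟦ x ⟧ ⟦ y ⟧) (K.sym (homo y x))))

-- Groups isomorphic to ℤ_P, with a topological generator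

module Procyclic
  (P : Pred ℕ 0ℓ) (P⊆Prime : P ⊆ Prime)
  (Ω : TopologicalGroup o) (Ω≅ℤP : Ω ≅ ℤ[ P ])
  (ω : TopologicalGroup.Carrier Ω) (ω-generates : IsTopologicalGenerator Ω ω)
  where

  private
    module T = Transport Ω≅ℤP
    module Z = ℤP P P⊆Prime

  open TopologicalGroup Ω

  infixr 8 _•_

  _•_ : ℕ → Carrier → Carrier
  _•_ = _×_ rawMonoid

  opaque
    ∙-comm : Commutative _≈_ _∙_
    ∙-comm = T.pull-comm (λ x y p p∈P n → mod-reflexive (ℤ.+-comm (ℤₚ.residue (x p p∈P) n) _))

  abelianGroup : AbelianGroup o o
  abelianGroup = record
    { isAbelianGroup = record { isGroup = Group.isGroup group ; comm = ∙-comm } }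

  open AbelianGroupProperties abelianGroup using (xyx⁻¹≈y)
  open GroupProperties group using (x∙y⁻¹≈ε⇒x≈y; inverseʳ-unique; //-rightDividesʳ; ∙-cancelˡ; \\-leftDividesˡ)
  open CommutativeMonoidMult (AbelianGroup.commutativeMonoid abelianGroup) public
    using () renaming
    ( ×-homo-+ to •-homo-+; ×-assocˡ to •-assocˡ; ×-congʳ to •-congʳ; ×-distrib-+ to •-distrib-∙ )
  open SetoidReasoning setoid

  •-comm : ∀ m n x → m • n • x ≈ n • m • x
  •-comm m n x = begin
    m • n • x    ≈⟨ •-assocˡ x m n ⟩
    (m * n) • x  ≡⟨ cong (_• x) (ℕ.*-comm m n) ⟩
    (n * m) • x  ≈⟨ •-assocˡ x n m ⟨
    n • m • x    ∎

  •-⁻¹ : ∀ n x → n • (x ⁻¹) ≈ (n • x) ⁻¹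
  •-⁻¹ n x = inverseʳ-unique _ _ (begin
    n • x ∙ n • (x ⁻¹)  ≈⟨ •-distrib-∙ x (x ⁻¹) n ⟨
    n • (x ∙ x ⁻¹)    ≈⟨ •-congʳ n (inverseʳ x) ⟩
    n • ε             ≈⟨ •-ε group n ⟩
    ε                 ∎)

  opaque
    •-cancelˡ : ∀ n .{{_ : NonZero n}} {x y} → n • x ≈ n • y → x ≈ y
    •-cancelˡ n {x} {y} eq = x∙y⁻¹≈ε⇒x≈y x y (T.pull-torsion n (Z.torsion-free n) nxy≈ε)
      where
      nxy≈ε : n • (x ∙ y ⁻¹) ≈ ε
      nxy≈ε = begin
        n • (x ∙ y ⁻¹)      ≈⟨ •-distrib-∙ x (y ⁻¹) n ⟩
        n • x ∙ n • (y ⁻¹)    ≈⟨ ∙-cong eq (•-⁻¹ n y) ⟩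
        n • y ∙ (n • y) ⁻¹  ≈⟨ inverseʳ _ ⟩
        ε                   ∎

  Multiple : ℕ → Pred Carrier o
  Multiple n x = ∃[ z ] x ≈ n • z

  multiples : ℕ → Subgroup Ω o
  multiples n = record
    { ⟨_⟩  = Multiple n
    ; resp = λ x≈y (z , x≈nz) → z , trans (sym x≈y) x≈nz
    ; ε∈   = ε , sym (•-ε group n)
    ; ∙∈   = λ (y , p) (z , q) → y ∙ z , trans (∙-cong p q) (sym (•-distrib-∙ y z n))
    ; ⁻¹∈  = λ (z , p) → z ⁻¹ , trans (⁻¹-cong p) (sym (•-⁻¹ n z))
    }

  opaque
    -- A whole ball around 0 consists of multiples of `n`; translated to a point of the coset it
    -- stays inside the coset, and continuity of `to` pulls it back to Ω.
    coset-open : ∀ n .{{_ : NonZero n}} y → IsOpen (λ x → (y ⁻¹ ∙ x) ∈ Multiple n)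
    coset-open n y = locally-open⇒open {G = Ω} λ {x} (z , y⁻¹x≈nz) →
      let V , V-open , x∈V , V⊆ = T.continuous {x} (Z.ball-open (suc n) n T.⟦ x ⟧) (λ _ _ _ _ _ → mod-refl)
      in V , V-open , x∈V , λ {x′} x′∈V →
        let w , eq = Z.near⇒multiple n T.⟦ x ⟧ T.⟦ x′ ⟧ (V⊆ x′∈V)
        in Subgroup.resp (multiples n)
             (trans (assoc _ _ _) (∙-congˡ (\\-leftDividesˡ x x′)))
             (Subgroup.∙∈ (multiples n) (z , y⁻¹x≈nz) (T.from w , ≈-coset {G = Ω} (T.pull-∙• {x′} {x} n {w} eq)))

    infinitely-divisible⇒ε : ∀ {x} → (∀ n .{{_ : NonZero n}} → x ∈ Multiple n) → x ≈ ε
    infinitely-divisible⇒ε {x} div = T.pull-ε {x} (Z.infinitely-divisible⇒0 T.⟦ x ⟧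
      λ n → let z , eq = div n in T.⟦ z ⟧ , T.push-• {x} n {z} eq)

    prime-to-P⇒multiple : ∀ q .{{_ : NonZero q}} → (∀ {p} → p ∈ P → ¬ p ∣ q) → ∀ x → x ∈ Multiple q
    prime-to-P⇒multiple q P∤q x =
      let z , eq = Z.prime-to-P⇒multiple q P∤q T.⟦ x ⟧ in T.from z , T.pull-• {x} q {z} eq

    not-divisible : ∀ {p} → p ∈ P → ∃[ x ] ¬ x ∈ Multiple p
    not-divisible {p} p∈P =
      let x , p∤x = Z.not-divisible p∈P in T.from x , λ p∣x → p∤x (T.push-divisible p {x} p∣x)

  opaque
    -- The coset x + nΩ is open, so the dense subgroup generated by ω meets it.
    ω-approximates : ∀ n .{{_ : NonZero n}} x → ∃[ i ] i < n ∧ (∃[ z ] x ≈ i • ω ∙ n • z)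
    ω-approximates n x
      with w , (z , x⁻¹w≈nz) , w∈ ← ω-generates x (coset-open n x)
             (Subgroup.resp (multiples n) (sym (inverseˡ x)) (Subgroup.ε∈ (multiples n)))
      with i , j , eq ← generated⇒power-quotient {G = Ω} w∈
      = k % n , m%n<n k n , (k / n) • ω ∙ (j • ω ∙ z) ⁻¹ , (begin
        x                                         ≈⟨ //-rightDividesʳ (n • v) x ⟨
        x ∙ n • v ∙ (n • v) ⁻¹                    ≈⟨ ∙-cong x∙nv≈kω (sym (•-⁻¹ n v)) ⟩
        k • ω ∙ n • (v ⁻¹)                          ≈⟨ ∙-congʳ kω ⟩
        (k % n) • ω ∙ n • (k / n) • ω ∙ n • (v ⁻¹)    ≈⟨ assoc _ _ _ ⟩
        (k % n) • ω ∙ (n • (k / n) • ω ∙ n • (v ⁻¹))  ≈⟨ ∙-congˡ (•-distrib-∙ _ _ n) ⟨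
        (k % n) • ω ∙ n • ((k / n) • ω ∙ v ⁻¹)      ∎)
      where
      k : ℕ
      -- The point of the coset is (i - j)ω; modulo `n` the negative exponent -j may be replaced by
      -- j (n - 1).
      k = i + j * ℕ.pred n
      v : Carrier
      v = j • ω ∙ z
      kω : k • ω ≈ (k % n) • ω ∙ n • (k / n) • ω
      kω = begin
        k • ω                          ≡⟨ cong (_• ω) (m≡m%n+[m/n]*n k n) ⟩
        (k % n + k / n * n) • ω        ≈⟨ •-homo-+ ω (k % n) (k / n * n) ⟩
        (k % n) • ω ∙ (k / n * n) • ω  ≡⟨ cong (λ l → (k % n) • ω ∙ l • ω) (ℕ.*-comm (k / n) n) ⟩
        (k % n) • ω ∙ (n * (k / n)) • ω  ≈⟨ ∙-congˡ (•-assocˡ ω n (k / n)) ⟨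
        (k % n) • ω ∙ n • (k / n) • ω  ∎
      njω : n • j • ω ≈ j • ω ∙ (j * ℕ.pred n) • ω
      njω = begin
        n • j • ω                     ≈⟨ •-assocˡ ω n j ⟩
        (n * j) • ω                   ≡⟨ cong (_• ω) (ℕ.*-comm n j) ⟩
        (j * n) • ω                   ≡⟨ cong (λ l → (j * l) • ω) (ℕ.suc-pred n) ⟨
        (j * suc (ℕ.pred n)) • ω      ≡⟨ cong (_• ω) (ℕ.*-suc j (ℕ.pred n)) ⟩
        (j + j * ℕ.pred n) • ω        ≈⟨ •-homo-+ ω j (j * ℕ.pred n) ⟩
        j • ω ∙ (j * ℕ.pred n) • ω    ∎
      x∙nv≈kω : x ∙ n • v ≈ k • ω
      x∙nv≈kω = begin
        x ∙ n • (j • ω ∙ z)                            ≈⟨ ∙-congˡ (•-distrib-∙ _ _ n) ⟩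
        x ∙ (n • j • ω ∙ n • z)                        ≈⟨ ∙-congˡ (∙-comm _ _) ⟩
        x ∙ (n • z ∙ n • j • ω)                        ≈⟨ assoc _ _ _ ⟨
        x ∙ n • z ∙ n • j • ω                          ≈⟨ ∙-cong (coset-≈ {G = Ω} x⁻¹w≈nz) (sym njω) ⟨
        w ∙ (j • ω ∙ (j * ℕ.pred n) • ω)               ≈⟨ assoc _ _ _ ⟨
        w ∙ j • ω ∙ (j * ℕ.pred n) • ω                 ≈⟨ ∙-congʳ eq ⟩
        i • ω ∙ (j * ℕ.pred n) • ω                     ≈⟨ •-homo-+ ω i (j * ℕ.pred n) ⟨
        k • ω                                          ∎

  -- If p did not divide k, Bézout would make ω, hence every element of Ω, a multiple of p.
  ω-multiple⇒∣ : ∀ {p} → p ∈ P → ∀ {k} → (k • ω) ∈ Multiple p → p ∣ k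
  ω-multiple⇒∣ {p} p∈P {k} kω∈ with p ∣? k
  ... | yes p∣k = p∣k
  ... | no  p∤k with prime⇒irreducible (P⊆Prime p∈P) (gcd[m,n]∣n k p)
  ...   | inj₂ gcd≡p = contradiction (subst (_∣ k) gcd≡p (gcd[m,n]∣m k p)) p∤k
  ...   | inj₁ gcd≡1 with x , p∤x ← not-divisible p∈P
                        | i , _ , z , x≈ ← ω-approximates p {{prime⇒nonZero (P⊆Prime p∈P)}} (not-divisible p∈P .proj₁) =
    contradiction (M.resp (sym x≈) (M.∙∈ (•∈ (multiples p) i ω∈) (z , refl))) p∤x
    where
    module M = Subgroup (multiples p)
    ω∈ : ω ∈ Multiple p
    ω∈ = M.resp (identityʳ ω) (subst (λ d → (d • ω) ∈ Multiple p) gcd≡1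
      (gcd-•∈ (multiples p) k p ω kω∈ (ω , refl)))

  -- Primes are peeled off one at a time: `ω-multiple⇒∣` splits `p` off `k`, and torsion-freeness
  -- cancels it on both sides, so repeated primes do no harm.
  product-∣ : ∀ {ps} → All P ps → ∀ {k} → (k • ω) ∈ Multiple (product ps) → product ps ∣ k
  product-∣ []                       _ = ℕ∣.1∣ _
  product-∣ {p ∷ ps} (p∈P ∷ ps⊆P) {k} (z , kω≈)
    with divides l ≡.refl ← ω-multiple⇒∣ p∈P {k} (product ps • z , trans kω≈ (sym (•-assocˡ z p (product ps))))
    = subst (p * product ps ∣_) (ℕ.*-comm p l) (ℕ∣.*-monoʳ-∣ p (product-∣ ps⊆P (z ,
        •-cancelˡ p {{prime⇒nonZero (P⊆Prime p∈P)}} (begin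
          p • l • ω             ≈⟨ •-assocˡ ω p l ⟩
          (p * l) • ω           ≡⟨ cong (_• ω) (ℕ.*-comm p l) ⟩
          (l * p) • ω           ≈⟨ kω≈ ⟩
          (p * product ps) • z  ≈⟨ •-assocˡ z p (product ps) ⟨
          p • product ps • z    ∎))))

  -- The numbers n for which the index of nΩ in Ω is n itself.
  IsSupported : ℕ → Set o
  IsSupported n = ∀ {k} → (k • ω) ∈ Multiple n → n ∣ k

  P-number⇒supported : ∀ n .{{_ : NonZero n}} → (∀ {p} → Prime p → p ∣ n → p ∈ P) → IsSupported n
  P-number⇒supported n n-primes = subst IsSupported (≡.sym (isFactorisation n-factors)) (product-∣
    (All.tabulate λ p∈ → n-primes (All.lookup (factorsPrime n-factors) p∈)
      (subst (_ ∣_) (≡.sym (isFactorisation n-factors)) (∈⇒∣product p∈))))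
    where n-factors = factorise n

  supported-cong : ∀ {n} → IsSupported n → ∀ {i j z} → j • ω ≈ i • ω ∙ n • z → n ∣ ∣ j - i ∣
  supported-cong {n} supp {i} {j} {z} eq with ℕ.≤-total i j
  ... | inj₁ i≤j = subst (n ∣_) (≡.sym (ℕ.m≤n⇒∣n-m∣≡n∸m i≤j)) (supp (z , ∙-cancelˡ (i • ω) _ _ (begin
    i • ω ∙ (j ∸ i) • ω  ≈⟨ •-∸ group ω i≤j ⟩
    j • ω                ≈⟨ eq ⟩
    i • ω ∙ n • z        ∎)))
  ... | inj₂ j≤i = subst (n ∣_) (≡.sym (ℕ.m≤n⇒∣m-n∣≡n∸m j≤i)) (supp (z ⁻¹ , ∙-cancelˡ (j • ω) _ _ (begin
    j • ω ∙ (i ∸ j) • ω          ≈⟨ •-∸ group ω j≤i ⟩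
    i • ω                        ≈⟨ //-rightDividesʳ (n • z) _ ⟨
    i • ω ∙ n • z ∙ (n • z) ⁻¹   ≈⟨ ∙-cong (sym eq) (sym (•-⁻¹ n z)) ⟩
    j • ω ∙ n • (z ⁻¹)             ∎)))

  abelian-normal : (A : Subgroup Ω a) (B : Subgroup Ω b) → IsNormalIn A B
  abelian-normal A B {y} {x} _ = Subgroup.resp B (sym (xyx⁻¹≈y y x))

  -- If i f ω lies in B then so does gcd(i, m) f ω, so A / B has at most gcd(i, m) elements
  -- and m divides i.
  index⇒multiples : (A : Subgroup Ω a) (B : Subgroup Ω b) → ∀ {f m} → ⟨ A ⟩ ≐ Multiple f →
                    ⟨ B ⟩ ⊆ ⟨ A ⟩ → [ A ∶ B ]≡ m → ⟨ B ⟩ ≐ Multiple (f * m)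
  index⇒multiples A B {f} {m} (A⊆fΩ , fΩ⊆A) B⊆A index = B⊆fmΩ , fmΩ⊆B
    where
    module B = Subgroup B
    open Setoid (LeftCosets A B) using () renaming (_≈_ to _≋_; sym to ≋-sym; trans to ≋-trans)
    instance
      m≢0 : NonZero m
      m≢0 = index⇒nonZero {A = A} {B = B} index

    fmΩ⊆B : Multiple (f * m) ⊆ ⟨ B ⟩
    fmΩ⊆B {x} (z , x≈fmz) = B.resp (begin
      m • f • z    ≈⟨ •-comm m f z ⟩
      f • m • z    ≈⟨ •-assocˡ z f m ⟩
      (f * m) • z  ≈⟨ x≈fmz ⟨
      x            ∎)
      (index-power∈ A B (abelian-normal A B) index (fΩ⊆A (z , refl)))

    expand : ∀ {x y} i z → x ≈ f • y → y ≈ i • ω ∙ m • z → x ≈ i • f • ω ∙ (f * m) • z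
    expand {x} {y} i z x≈ y≈ = begin
      x                          ≈⟨ x≈ ⟩
      f • y                      ≈⟨ •-congʳ f y≈ ⟩
      f • (i • ω ∙ m • z)        ≈⟨ •-distrib-∙ _ _ f ⟩
      f • i • ω ∙ f • m • z      ≈⟨ ∙-cong (•-comm f i ω) (•-assocˡ z f m) ⟩
      i • f • ω ∙ (f * m) • z    ∎

    mfω∈B : (m • f • ω) ∈ ⟨ B ⟩
    mfω∈B = fmΩ⊆B (ω , trans (•-comm m f ω) (•-assocˡ ω f m))

    module _ {i} (ifω∈B : (i • f • ω) ∈ ⟨ B ⟩) where
      private
        d = gcd i m
        instance
          d≢0 : NonZero d
          d≢0 = ℕ.≢-nonZero (λ d≡0 → ℕ.≢-nonZero⁻¹ m (ℕ∣.0∣⇒≡0 (subst (_∣ m) d≡0 (gcd[m,n]∣n i m))))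

      -- Modulo `B` every element of `A` is a multiple of fω, and as dfω lies in `B` only the
      -- remainder of the coefficient modulo `d` matters.
      remainder : ∃ ⟨ A ⟩ → ℕ
      remainder (x , x∈A) = proj₁ (ω-approximates m (proj₁ (A⊆fΩ x∈A))) % d

      remainder-≋ : ∀ x → ((remainder x • f • ω) ⁻¹ ∙ proj₁ x) ∈ ⟨ B ⟩
      remainder-≋ (x , x∈A) =
        let y , x≈fy = A⊆fΩ x∈A
            k , _ , z , y≈ = ω-approximates m y
        in B.resp (sym (≈-coset {G = Ω} (begin
          x                                               ≈⟨ expand k z x≈fy y≈ ⟩
          k • f • ω ∙ (f * m) • z                         ≡⟨ cong (λ l → l • f • ω ∙ (f * m) • z) (m≡m%n+[m/n]*n k d) ⟩
          (k % d + k / d * d) • f • ω ∙ (f * m) • z       ≈⟨ ∙-congʳ (•-homo-+ (f • ω) (k % d) (k / d * d)) ⟩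
          (k % d) • f • ω ∙ (k / d * d) • f • ω ∙ (f * m) • z    ≈⟨ assoc _ _ _ ⟩
          (k % d) • f • ω ∙ ((k / d * d) • f • ω ∙ (f * m) • z)  ∎)))
        (B.∙∈ (B.resp (•-assocˡ (f • ω) (k / d) d) (•∈ B (k / d) (gcd-•∈ B i m (f • ω) ifω∈B mfω∈B)))
              (fmΩ⊆B (z , refl)))

      m≤d : m ≤ d
      m≤d = Fin.injective⇒≤ {f = λ c → fromℕ< (remainder<d (u c))} λ {c} {c′} eq →
        injective c c′ (≡.trans (≡.sym (Fin.toℕ-fromℕ< _)) (≡.trans (cong toℕ eq) (Fin.toℕ-fromℕ< _)))
        where
        u : Fin m → ∃ ⟨ A ⟩
        u = Inverse.to index
        remainder<d : ∀ x → remainder x < d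
        remainder<d (x , x∈A) = m%n<n (proj₁ (ω-approximates m (proj₁ (A⊆fΩ x∈A)))) d
        injective : ∀ c c′ → remainder (u c) ≡ remainder (u c′) → c ≡ c′
        injective c c′ eq = ≡.trans (≡.sym (Inverse.strictlyInverseʳ index c)) (≡.trans
          (Inverse.from-cong index {u c} {u c′} (≋-trans {u c} {w} {u c′}
            (≋-sym {w} {u c} (remainder-≋ (u c)))
            (subst (λ r → ((r • f • ω) ⁻¹ ∙ proj₁ (u c′)) ∈ ⟨ B ⟩) (≡.sym eq) (remainder-≋ (u c′)))))
          (Inverse.strictlyInverseʳ index c′))
          where
          w : ∃ ⟨ A ⟩
          w = remainder (u c) • f • ω , fΩ⊆A (remainder (u c) • ω , •-comm (remainder (u c)) f ω)

      m∣i : m ∣ i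
      m∣i = subst (_∣ i) (ℕ.≤-antisym (ℕ∣.∣⇒≤ (gcd[m,n]∣n i m)) m≤d) (gcd[m,n]∣m i m)

    ∣⇒∈fmΩ : ∀ {x y i z} → x ≈ f • y → y ≈ i • ω ∙ m • z → m ∣ i → x ∈ Multiple (f * m)
    ∣⇒∈fmΩ {x} {z = z} x≈fy y≈ (divides q ≡.refl) = q • ω ∙ z , (begin
        x                                      ≈⟨ expand (q * m) z x≈fy y≈ ⟩
        (q * m) • f • ω ∙ (f * m) • z          ≈⟨ ∙-congʳ (•-comm (q * m) f ω) ⟩
        f • (q * m) • ω ∙ (f * m) • z          ≡⟨ cong (λ l → f • l • ω ∙ (f * m) • z) (ℕ.*-comm q m) ⟩
        f • (m * q) • ω ∙ (f * m) • z          ≈⟨ ∙-congʳ (•-congʳ f (•-assocˡ ω m q)) ⟨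
        f • m • q • ω ∙ (f * m) • z            ≈⟨ ∙-congʳ (•-assocˡ (q • ω) f m) ⟩
        (f * m) • q • ω ∙ (f * m) • z          ≈⟨ •-distrib-∙ _ _ (f * m) ⟨
        (f * m) • (q • ω ∙ z)                  ∎)

    B⊆fmΩ : ⟨ B ⟩ ⊆ Multiple (f * m)
    B⊆fmΩ x∈B =
      let y , x≈fy = A⊆fΩ (B⊆A x∈B)
          i , _ , z , y≈ = ω-approximates m y
      in ∣⇒∈fmΩ {i = i} {z} x≈fy y≈ (m∣i {i} (∙-cancelʳ-∈ B (B.resp (expand i z x≈fy y≈) x∈B) (fmΩ⊆B (z , refl))))

  -- The elements i f ω with i < m represent the cosets: approximation modulo `m` reaches each of
  -- them, and `IsSupported m` keeps them apart. For an `m` prime to P they would all fall into one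
  -- coset.
  multiples⇒index : (A : Subgroup Ω a) (B : Subgroup Ω b) → ∀ {f m} .{{_ : NonZero f}} .{{_ : NonZero m}} →
                    IsSupported m → ⟨ A ⟩ ≐ Multiple f → ⟨ B ⟩ ≐ Multiple (f * m) → [ A ∶ B ]≡ m
  multiples⇒index A B {f} {m} supp (A⊆fΩ , fΩ⊆A) (B⊆fmΩ , fmΩ⊆B) =
    index-intro {G = Ω} {A = A} {B = B} to from section injective
    where
    to : Fin m → ∃ ⟨ A ⟩
    to i = f • toℕ i • ω , fΩ⊆A (_ , refl)

    from : ∃ ⟨ A ⟩ → Fin m
    from (x , x∈A) = fromℕ< (proj₁ (proj₂ (ω-approximates m (proj₁ (A⊆fΩ x∈A)))))

    section : ∀ x → ((proj₁ (to (from x))) ⁻¹ ∙ proj₁ x) ∈ ⟨ B ⟩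
    section (x , x∈A) =
      let y , x≈fy = A⊆fΩ x∈A
          k , k<m , z , y≈ = ω-approximates m y
      in fmΩ⊆B (z , ≈-coset {G = Ω} (begin
        x                          ≈⟨ x≈fy ⟩
        f • y                      ≈⟨ •-congʳ f y≈ ⟩
        f • (k • ω ∙ m • z)        ≈⟨ •-distrib-∙ _ _ f ⟩
        f • k • ω ∙ f • m • z      ≈⟨ ∙-congˡ (•-assocˡ z f m) ⟩
        f • k • ω ∙ (f * m) • z    ≡⟨ cong (λ l → f • l • ω ∙ (f * m) • z) (Fin.toℕ-fromℕ< k<m) ⟨
        f • toℕ (fromℕ< k<m) • ω ∙ (f * m) • z  ∎))

    injective : ∀ {i j} → ((f • toℕ i • ω) ⁻¹ ∙ f • toℕ j • ω) ∈ ⟨ B ⟩ → i ≡ j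
    injective {i} {j} i≋j with z , eq ← B⊆fmΩ i≋j =
      Fin.toℕ-injective (≡.sym (ℕ.∣m-n∣≡0⇒m≡n (small (supported-cong supp {toℕ i} {toℕ j} {z} (•-cancelˡ f (begin
        f • toℕ j • ω                ≈⟨ coset-≈ {G = Ω} eq ⟩
        f • toℕ i • ω ∙ (f * m) • z  ≈⟨ ∙-congˡ (•-assocˡ z f m) ⟨
        f • toℕ i • ω ∙ f • m • z    ≈⟨ •-distrib-∙ _ _ f ⟨
        f • (toℕ i • ω ∙ m • z)      ∎))))))
      where
      ∣j-i∣<m : ∣ toℕ j - toℕ i ∣ < m
      ∣j-i∣<m = ℕ.≤-<-trans (ℕ.∣m-n∣≤m⊔n (toℕ j) (toℕ i)) (ℕ.⊔-pres-<m (Fin.toℕ<n j) (Fin.toℕ<n i))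
      small : m ∣ ∣ toℕ j - toℕ i ∣ → ∣ toℕ j - toℕ i ∣ ≡ 0
      small m∣ with ∣ toℕ j - toℕ i ∣ | ∣j-i∣<m
      ... | zero  | _  = ≡.refl
      ... | suc _ | lt = contradiction (ℕ∣.∣⇒≤ m∣) (ℕ.<⇒≱ lt)

  -- The P-part of a natural number

  module _ (P? : Decidable P) where

    filter-product : ∀ ps → product ps ≡ product (filter P? ps) * product (filter (¬? ∘ P?) ps)
    filter-product []       = ≡.refl
    filter-product (p ∷ ps) with P? p
    ... | yes _ = ≡.trans (cong (p *_) (filter-product ps)) (≡.sym (ℕ.*-assoc p _ _))
    ... | no  _ = ≡.trans (cong (p *_) (filter-product ps)) (swap p (product (filter P? ps)) _)
      where
      swap : ∀ x y z → x * (y * z) ≡ y * (x * z)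
      swap x y z = ≡.trans (≡.sym (ℕ.*-assoc x y z)) (≡.trans (cong (_* z) (ℕ.*-comm x y)) (ℕ.*-assoc y x z))

    module _ (n : ℕ) .{{_ : NonZero n}} where
      private
        ps = factors (factorise n)
        q = product (filter (¬? ∘ P?) ps)
        ps-prime : All Prime ps
        ps-prime = factorsPrime (factorise n)
        q-prime : All Prime (filter (¬? ∘ P?) ps)
        q-prime = All.filter⁺ (¬? ∘ P?) ps-prime

      P-part-nonZero : NonZero (P-part P? n)
      P-part-nonZero = productOfPrimes≢0 (All.filter⁺ P? ps-prime)

      P-part-supported : IsSupported (P-part P? n)
      P-part-supported = product-∣ (All.all-filter P? ps)

      -- The complementary factor `q` has no prime divisor in P, so every element of Ω is a multiple
      -- of `q`.
      multiple-P-part : ∀ f → Multiple (f * n) ≐ Multiple (f * P-part P? n)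
      multiple-P-part f =
        (λ {x} (z , x≈) → q • z , (begin
          x                             ≈⟨ x≈ ⟩
          (f * n) • z                   ≡⟨ cong (_• z) f*n≡ ⟩
          (f * P-part P? n * q) • z     ≈⟨ •-assocˡ z (f * P-part P? n) q ⟨
          (f * P-part P? n) • q • z     ∎)) ,
        (λ {x} (z , x≈) →
          let y , z≈qy = prime-to-P⇒multiple q {{productOfPrimes≢0 q-prime}}
                           (λ p∈P p∣q → All.lookup (All.all-filter (¬? ∘ P?) ps)
                             (factorisationHasAllPrimeFactors (P⊆Prime p∈P) p∣q q-prime) p∈P) z
          in y , (begin
            x                             ≈⟨ x≈ ⟩
            (f * P-part P? n) • z         ≈⟨ •-congʳ (f * P-part P? n) z≈qy ⟩
            (f * P-part P? n) • q • y     ≈⟨ •-assocˡ y (f * P-part P? n) q ⟩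
            (f * P-part P? n * q) • y     ≡⟨ cong (_• y) f*n≡ ⟨
            (f * n) • y                   ∎))
        where
        f*n≡ : f * n ≡ f * P-part P? n * q
        f*n≡ = ≡.trans (cong (f *_) (≡.trans (isFactorisation (factorise n)) (filter-product ps)))
                 (≡.sym (ℕ.*-assoc f _ q))

-- Closures of cyclic subgroups, and conjugation

module _ {G : TopologicalGroup g} where
  open TopologicalGroup G
  open GroupProperties group
  open MonoidMult monoid using (×-homo-+; ×-assocˡ)
  open SetoidReasoning setoid

  private
    infixr 8 _•_
    _•_ : ℕ → Carrier → Carrier
    _•_ = _×_ rawMonoid

  generated : Carrier → Subgroup G g
  generated h = record { ⟨_⟩ = Generated {G = G} h ; resp = resp ; ε∈ = unit ; ∙∈ = mul ; ⁻¹∈ = inv }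

  closureSubgroup : Carrier → Subgroup G _
  closureSubgroup h = record
    { ⟨_⟩  = ⟨_⟩ᶜ {G = G} h
    ; resp = λ x≈y x∈ V-open y∈V → x∈ V-open (open-resp-≈ V-open (sym x≈y) y∈V)
    ; ε∈   = λ _ ε∈V → ε , ε∈V , unit
    ; ∙∈   = λ x∈ y∈ V-open xy∈V →
        let _ , _ , A-open , B-open , x∈A , y∈B , AB⊆V = ∙-continuous V-open xy∈V
            x′ , x′∈A , x′∈ = x∈ A-open x∈A
            y′ , y′∈B , y′∈ = y∈ B-open y∈B
        in x′ ∙ y′ , AB⊆V x′∈A y′∈B , mul x′∈ y′∈
    ; ⁻¹∈  = λ x∈ V-open x⁻¹∈V →
        let x′ , x′⁻¹∈V , x′∈ = x∈ (⁻¹-continuous V-open) x⁻¹∈V in x′ ⁻¹ , x′⁻¹∈V , inv x′∈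
    }

  generated⊆closure : ∀ {h} → Generated {G = G} h ⊆ ⟨_⟩ᶜ {G = G} h
  generated⊆closure {_} {x} x∈ _ x∈V = x , x∈V , x∈

  closure-mono : ∀ {h k} → k ∈ Generated {G = G} h → ⟨_⟩ᶜ {G = G} k ⊆ ⟨_⟩ᶜ {G = G} h
  closure-mono k∈ x∈ V-open x∈V =
    let y , y∈V , y∈ = x∈ V-open x∈V in y , y∈V , generated⊆ (generated _) k∈ y∈

  module _ (A : Subgroup G a) where
    open Subgroup A using () renaming (resp to A-resp)

    coset-∈ʳ : ∀ {x y} → (x ⁻¹ ∙ y) ∈ ⟨ A ⟩ → x ∈ ⟨ A ⟩ → y ∈ ⟨ A ⟩
    coset-∈ʳ x⁻¹y∈A x∈A = ∙-cancelˡ-∈ A x⁻¹y∈A (Subgroup.⁻¹∈ A x∈A)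

    coset-∈ˡ : ∀ {x y} → (x ⁻¹ ∙ y) ∈ ⟨ A ⟩ → y ∈ ⟨ A ⟩ → x ∈ ⟨ A ⟩
    coset-∈ˡ x⁻¹y∈A y∈A = A-resp (⁻¹-involutive _) (Subgroup.⁻¹∈ A (∙-cancelʳ-∈ A x⁻¹y∈A y∈A))

    multiple-•∈ : ∀ {n h} → (n • h) ∈ ⟨ A ⟩ → ∀ {k} → n ∣ k → (k • h) ∈ ⟨ A ⟩
    multiple-•∈ {n} {h} nh∈A (divides q ≡.refl) = A-resp (×-assocˡ h q n) (•∈ A q nh∈A)

    power-quotient∈ : ∀ {n h} → (n • h) ∈ ⟨ A ⟩ → ∀ {x} i j → n ∣ ∣ i - j ∣ → x ∙ j • h ≈ i • h → x ∈ ⟨ A ⟩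
    power-quotient∈ {n} {h} nh∈A {x} i j n∣ eq with ℕ.≤-total j i
    ... | inj₁ j≤i = A-resp (sym (∙-cancelʳ (j • h) _ _ (begin
      x ∙ j • h            ≈⟨ eq ⟩
      i • h                ≡⟨ cong (_• h) (ℕ.m∸n+n≡m j≤i) ⟨
      (i ∸ j + j) • h      ≈⟨ ×-homo-+ h (i ∸ j) j ⟩
      (i ∸ j) • h ∙ j • h  ∎))) (multiple-•∈ nh∈A (subst (n ∣_) (ℕ.m≤n⇒∣n-m∣≡n∸m j≤i) n∣))
    ... | inj₂ i≤j = ∙-cancelʳ-∈ A (A-resp (sym (∙-cancelʳ (i • h) _ _ (begin
      x ∙ (j ∸ i) • h ∙ i • h    ≈⟨ assoc _ _ _ ⟩
      x ∙ ((j ∸ i) • h ∙ i • h)  ≈⟨ ∙-congˡ (×-homo-+ h (j ∸ i) i) ⟨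
      x ∙ (j ∸ i + i) • h        ≡⟨ cong (λ k → x ∙ k • h) (ℕ.m∸n+n≡m i≤j) ⟩
      x ∙ j • h                  ≈⟨ eq ⟩
      i • h                      ≈⟨ identityˡ _ ⟨
      ε ∙ i • h                  ∎))) (Subgroup.ε∈ A))
      (multiple-•∈ nh∈A (subst (n ∣_) (ℕ.m≤n⇒∣m-n∣≡n∸m i≤j) n∣))

  conj-∙ : ∀ x y z → x ∙ y ∙ z ∙ (x ∙ y) ⁻¹ ≈ x ∙ (y ∙ z ∙ y ⁻¹) ∙ x ⁻¹
  conj-∙ x y z = begin
    x ∙ y ∙ z ∙ (x ∙ y) ⁻¹       ≈⟨ ∙-cong (assoc x y z) (⁻¹-anti-homo-∙ x y) ⟩
    x ∙ (y ∙ z) ∙ (y ⁻¹ ∙ x ⁻¹)  ≈⟨ assoc _ _ _ ⟨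
    x ∙ (y ∙ z) ∙ y ⁻¹ ∙ x ⁻¹    ≈⟨ ∙-congʳ (assoc _ _ _) ⟩
    x ∙ (y ∙ z ∙ y ⁻¹) ∙ x ⁻¹    ∎

  conj-cong : ∀ {x y} z → x ≈ y → x ∙ z ∙ x ⁻¹ ≈ y ∙ z ∙ y ⁻¹
  conj-cong z x≈y = ∙-cong (∙-congʳ x≈y) (⁻¹-cong x≈y)

  conj-ε : ∀ z → ε ∙ z ∙ ε ⁻¹ ≈ z
  conj-ε z = trans (∙-cong (identityˡ z) ε⁻¹≈ε) (identityʳ z)

  conj-⁻¹ : ∀ x z → x ∙ (x ⁻¹ ∙ z ∙ x ⁻¹ ⁻¹) ∙ x ⁻¹ ≈ z
  conj-⁻¹ x z = begin
    x ∙ (x ⁻¹ ∙ z ∙ x ⁻¹ ⁻¹) ∙ x ⁻¹  ≈⟨ conj-∙ x (x ⁻¹) z ⟨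
    x ∙ x ⁻¹ ∙ z ∙ (x ∙ x ⁻¹) ⁻¹     ≈⟨ conj-cong z (inverseʳ x) ⟩
    ε ∙ z ∙ ε ⁻¹                     ≈⟨ conj-ε z ⟩
    z                                ∎

  -- Both directions of `Normalizes` are carried through the induction because conjugation by x ⁻¹
  -- preserves `A` by the backward direction for `x`.
  generated-normalizes : ∀ {A : Pred Carrier ℓ} {h} → A Respects _≈_ → Normalizes {G = G} h A →
                         ∀ {x} → x ∈ Generated {G = G} h → Normalizes {G = G} x A
  generated-normalizes {A = A} A-resp norm = go
    where
    open Equivalence
    go : ∀ {x} → x ∈ Generated {G = G} _ → Normalizes {G = G} x A
    go gen z = norm z
    go unit z = mk⇔ (A-resp (sym (conj-ε z))) (A-resp (conj-ε z))
    go (mul {x} {y} x∈ y∈) z = mk⇔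
      (A-resp (sym (conj-∙ x y z)) ∘ to (go x∈ _) ∘ to (go y∈ z))
      (from (go y∈ z) ∘ from (go x∈ _) ∘ A-resp (conj-∙ x y z))
    go (inv {x} x∈) z = mk⇔
      (from (go x∈ _) ∘ A-resp (sym (conj-⁻¹ x z)))
      (A-resp (conj-⁻¹ x z) ∘ to (go x∈ _))
    go (resp x≈y x∈) z = mk⇔
      (A-resp (conj-cong z x≈y) ∘ to (go x∈ z))
      (from (go x∈ z) ∘ A-resp (conj-cong z (sym x≈y)))

-- The Frobenius group

module FrobeniusGroup
  (em : ∀ {ℓ} → ExcludedMiddle ℓ)
  (P : Pred ℕ 0ℓ) (P⊆Prime : P ⊆ Prime)
  (G : TopologicalGroup g) (G-pro : IsPro G P)
  (Ω : TopologicalGroup o) (Ω≅ℤP : Ω ≅ ℤ[ P ])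
  (ω : TopologicalGroup.Carrier Ω) (ω-generates : IsTopologicalGenerator Ω ω)
  (d : ContinuousHom G Ω)
  where

  private
    module Ω = TopologicalGroup Ω
    module Ω-props = GroupProperties Ω.group

  open Procyclic P P⊆Prime Ω Ω≅ℤP ω ω-generates
  open TopologicalGroup G
  open GroupProperties group
  open ContinuousHom d
  open GroupMorphisms.IsGroupHomomorphism isHomomorphism
  open IsPro G-pro
  open IsProfinite isProfinite
  open Frobenius {P = P} (λ _ → em) {G = G} {Ω = Ω} ω d using (I; IsInertiallyFinite; IsFrobeniusGroup; Ω⁺)

  private
    infixr 8 _•ᴳ_
    _•ᴳ_ : ℕ → Carrier → Carrier
    _•ᴳ_ = _×_ rawMonoid

    ⟪_⟫ : Carrier → Pred Carrier _
    ⟪ h ⟫ = ⟨_⟩ᶜ {G = G} h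

  homo-\\ : ∀ x y → ⟦ x ⁻¹ ∙ y ⟧ Ω.≈ ⟦ x ⟧ Ω.⁻¹ Ω.∙ ⟦ y ⟧
  homo-\\ x y = Ω.trans (homo (x ⁻¹) y) (Ω.∙-congʳ (⁻¹-homo x))

  equal⇒kernel : ∀ {x y} → ⟦ x ⟧ Ω.≈ ⟦ y ⟧ → ⟦ x ⁻¹ ∙ y ⟧ Ω.≈ Ω.ε
  equal⇒kernel {x} {y} eq = Ω.trans (homo-\\ x y) (Ω.trans (Ω.∙-congˡ (Ω.sym eq)) (Ω.inverseˡ _))

  multiple-∣ : ∀ {m n} → m ∣ n → Multiple n ⊆ Multiple m
  multiple-∣ {m} (divides q ≡.refl) (z , x≈) =
    q • z , Ω.trans x≈ (Ω.trans (Ω.sym (•-assocˡ z q m)) (•-comm q m z))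

  preimage : ℕ → Subgroup G o
  preimage n = record
    { ⟨_⟩  = λ x → ⟦ x ⟧ ∈ Multiple n
    ; resp = λ x≈y → M.resp (⟦⟧-cong x≈y)
    ; ε∈   = M.resp (Ω.sym ε-homo) M.ε∈
    ; ∙∈   = λ p q → M.resp (Ω.sym (homo _ _)) (M.∙∈ p q)
    ; ⁻¹∈  = λ p → M.resp (Ω.sym (⁻¹-homo _)) (M.⁻¹∈ p)
    }
    where module M = Subgroup (multiples n)

  inertia : Subgroup G ℓ → Subgroup G (o ⊔ ℓ)
  inertia V = record
    { ⟨_⟩  = I V
    ; resp = λ x≈y (x∈V , dx≈ε) → V.resp x≈y x∈V , Ω.trans (⟦⟧-cong (sym x≈y)) dx≈ε
    ; ε∈   = V.ε∈ , ε-homo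
    ; ∙∈   = λ (x∈V , dx≈ε) (y∈V , dy≈ε) → V.∙∈ x∈V y∈V ,
               Ω.trans (homo _ _) (Ω.trans (Ω.∙-cong dx≈ε dy≈ε) (Ω.identityʳ Ω.ε))
    ; ⁻¹∈  = λ (x∈V , dx≈ε) → V.⁻¹∈ x∈V ,
               Ω.trans (⁻¹-homo _) (Ω.trans (Ω.⁻¹-cong dx≈ε) Ω-props.ε⁻¹≈ε)
    }
    where module V = Subgroup V

  inertia-conj : (V : Subgroup G ℓ) → ∀ {x z} → x ∈ ⟨ V ⟩ → z ∈ I V → (x ∙ z ∙ x ⁻¹) ∈ I V
  inertia-conj V {x} {z} x∈V (z∈V , dz≈ε) = V.∙∈ (V.∙∈ x∈V z∈V) (V.⁻¹∈ x∈V) , (begin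
    ⟦ x ∙ z ∙ x ⁻¹ ⟧                   ≈⟨ homo _ _ ⟩
    ⟦ x ∙ z ⟧ Ω.∙ ⟦ x ⁻¹ ⟧             ≈⟨ Ω.∙-cong (homo x z) (⁻¹-homo x) ⟩
    ⟦ x ⟧ Ω.∙ ⟦ z ⟧ Ω.∙ ⟦ x ⟧ Ω.⁻¹     ≈⟨ AbelianGroupProperties.xyx⁻¹≈y abelianGroup ⟦ x ⟧ ⟦ z ⟧ ⟩
    ⟦ z ⟧                              ≈⟨ dz≈ε ⟩
    Ω.ε                                ∎)
    where
    module V = Subgroup V
    open SetoidReasoning Ω.setoid

  -- The position modulo `N` and the value of d modulo `n` are controlled at once, so that a single
  -- approximating element serves both purposes.
  neighbourhood : ∀ c {N} → IsOpen N → ε ∈ N → ∀ n .{{_ : NonZero n}} →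
    ∃[ W ] IsOpen W ∧ c ∈ W ∧ (∀ {y} → y ∈ W → (c ⁻¹ ∙ y) ∈ N ∧ (⟦ c ⟧ Ω.⁻¹ Ω.∙ ⟦ y ⟧) ∈ Multiple n)
  neighbourhood c N-open ε∈N n =
    let _ , B , _ , B-open , c⁻¹∈A , c∈B , AB⊆N =
          ∙-continuous {c ⁻¹} {c} N-open (open-resp-≈ N-open (sym (inverseˡ c)) ε∈N)
        V , V-open , c∈V , V⊆ = continuous {c} (coset-open n ⟦ c ⟧)
          (Subgroup.resp (multiples n) (Ω.sym (Ω.inverseˡ _)) (Subgroup.ε∈ (multiples n)))
    in (B ∩ V) , open-∩ B-open V-open , (c∈B , c∈V) , λ (y∈B , y∈V) → AB⊆N c⁻¹∈A y∈B , V⊆ y∈V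

  approximate : ∀ {c h N} → c ∈ ⟪ h ⟫ → IsOpen N → ε ∈ N → ∀ n .{{_ : NonZero n}} →
    ∃[ x ] x ∈ Generated {G = G} h ∧ (c ⁻¹ ∙ x) ∈ N ∧ (⟦ c ⟧ Ω.⁻¹ Ω.∙ ⟦ x ⟧) ∈ Multiple n
  approximate {c} c∈ N-open ε∈N n =
    let _ , W-open , c∈W , W⊆ = neighbourhood c N-open ε∈N n
        x , x∈W , x∈ = c∈ W-open c∈W
    in x , x∈ , W⊆ x∈W

  closure⊆closed : (H : Subgroup G g) → IsClosed {G = G} ⟨ H ⟩ → ∀ {h} → h ∈ ⟨ H ⟩ → ⟪ h ⟫ ⊆ ⟨ H ⟩
  closure⊆closed H closed h∈H {c} c∈ with em {P = c ∈ ⟨ H ⟩}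
  ... | yes c∈H = c∈H
  ... | no  c∉H = let x , x∉H , x∈ = c∈ closed c∉H in contradiction (generated⊆ H h∈H x∈) x∉H

  open-subgroup⇒normal : (U H : Subgroup G g) → _IsOpenSubgroupOf_ {G = G} U H →
    Σ[ N ∈ Subgroup G g ] IsNormal N ∧ IsOpen ⟨ N ⟩ ∧ (∀ {x} → x ∈ ⟨ N ⟩ → x ∈ ⟨ H ⟩ → x ∈ ⟨ U ⟩)
  open-subgroup⇒normal U H (_ , W , W-open , U⊆W∩H , W∩H⊆U) =
    let N , N-normal , N-open , N⊆W = basis W-open (proj₁ (U⊆W∩H (Subgroup.ε∈ U)))
    in N , N-normal , N-open , λ x∈N x∈H → W∩H⊆U (N⊆W x∈N , x∈H)

  -- Open subgroups are closed: if `c` is congruent modulo `N` to some x in `U`, then c ⁻¹ ∙ x lies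
  -- in N ∩ H ⊆ U. The modulus 1 in `approximate` leaves the value of d free.
  closure⊆open-subgroup : (U H : Subgroup G g) → _IsOpenSubgroupOf_ {G = G} U H → IsClosed {G = G} ⟨ H ⟩ →
                          ∀ {h} → h ∈ ⟨ U ⟩ → ⟪ h ⟫ ⊆ ⟨ U ⟩
  closure⊆open-subgroup U H U≤H H-closed {h} h∈U c∈ =
    let N , _ , N-open , N∩H⊆U = open-subgroup⇒normal U H U≤H
        x , x∈ , c⁻¹x∈N , _ = approximate c∈ N-open (Subgroup.ε∈ N) 1
        x∈U = generated⊆ U h∈U x∈
        c∈H = closure⊆closed H H-closed (proj₁ U≤H h∈U) c∈
    in coset-∈ˡ U (N∩H⊆U c⁻¹x∈N (Subgroup.∙∈ H (Subgroup.⁻¹∈ H c∈H) (proj₁ U≤H x∈U))) x∈U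

  generated-image : ∀ {h} b → ⟦ h ⟧ Ω.≈ b • ω → ∀ {x} → x ∈ Generated {G = G} h → ⟦ x ⟧ ∈ Multiple b
  generated-image b dh≈bω = generated⊆ (preimage b) (ω , dh≈bω)

  -- The coset of d(c) modulo bΩ is open, so it contains the image of some element of ⟨h⟩, and that
  -- image lies in bΩ.
  closure-image : ∀ {h} b .{{_ : NonZero b}} → ⟦ h ⟧ Ω.≈ b • ω → ∀ {c} → c ∈ ⟪ h ⟫ → ⟦ c ⟧ ∈ Multiple b
  closure-image b dh≈bω c∈ =
    let x , x∈ , _ , dc⁻¹dx∈ = approximate c∈ open-⊤ tt b
    in coset-∈ˡ (multiples b) dc⁻¹dx∈ (generated-image b dh≈bω x∈)

  -- Were b x not attained on the closure of ⟨h⟩, compactness would provide a single modulus n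
  -- such that no d(hⁱ) is congruent to b x modulo n; but x is congruent to some iω.
  closure-image-surjective : ∀ {h} b → ⟦ h ⟧ Ω.≈ b • ω → ∀ x → ∃[ c ] c ∈ ⟪ h ⟫ ∧ ⟦ c ⟧ Ω.≈ b • x
  closure-image-surjective {h} b dh≈bω x with em {P = ∃[ c ] c ∈ ⟪ h ⟫ ∧ ⟦ c ⟧ Ω.≈ b • x}
  ... | yes attained = attained
  ... | no  missed   =
    let is , is-cover = compact (λ c → proj₁ (separate c)) (λ c → proj₁ (proj₂ (separate c)))
                          (λ c → c , proj₁ (proj₂ (proj₂ (separate c))))
        -- A common multiple of the moduli of the finite subcover: a congruence modulo `n` implies
        -- the one modulo each of them.
        n = product (map modulus is)
        i , _ , z , x≈ = ω-approximates n {{product≢0 (All.map⁺ (All.universal modulus≢0 is))}} x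
        c , c∈is , ih∈V = find (is-cover (i •ᴳ h))
    in contradiction
         (multiple-∣ (∈⇒∣product (∈-map⁺ modulus c∈is)) (close i z n x≈))
         (proj₂ (proj₂ (proj₂ (proj₂ (proj₂ (separate c))))) ih∈V (•∈ (generated h) i gen))
    where
    Separated : Carrier → Set _
    Separated c = ∃[ V ] IsOpen V ∧ c ∈ V ∧ (∃[ n ] NonZero n ∧
      (∀ {y} → y ∈ V → y ∈ Generated {G = G} h → ¬ ((b • x) Ω.⁻¹ Ω.∙ ⟦ y ⟧) ∈ Multiple n))

    far : ∀ {c} → ¬ c ∈ ⟪ h ⟫ → Separated c
    far {c} c∉ with em {P = ∃[ V ] IsOpen V ∧ c ∈ V ∧ ¬ (V ≬ Generated {G = G} h)}
    ... | yes (V , V-open , c∈V , disjoint) =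
      -- `V` contains no element of ⟨h⟩, so any modulus would do and 1 is a placeholder.
      V , V-open , c∈V , 1 , _ , λ y∈V y∈ _ → disjoint (_ , y∈V , y∈)
    ... | no none = ⊥-elim (c∉ (λ {V} → meets V))
      where
      meets : ∀ V → IsOpen V → c ∈ V → V ≬ Generated {G = G} h
      meets V V-open c∈V with em {P = V ≬ Generated {G = G} h}
      ... | yes meet     = meet
      ... | no  disjoint = contradiction (V , V-open , c∈V , disjoint) none

    close-by : ∀ {c} → c ∈ ⟪ h ⟫ → Separated c
    close-by {c} c∈ with em {P = ∃[ n ] NonZero n ∧ ¬ ((b • x) Ω.⁻¹ Ω.∙ ⟦ c ⟧) ∈ Multiple n}
    ... | yes (n , n≢0 , bx≢dc) =
      let W , W-open , c∈W , W⊆ = neighbourhood c open-⊤ tt n {{n≢0}}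
      in W , W-open , c∈W , n , n≢0 , λ {y} y∈W _ bx≡dy → bx≢dc (Subgroup.resp (multiples n)
           (cancel (b • x) ⟦ c ⟧ ⟦ y ⟧)
           (Subgroup.∙∈ (multiples n) bx≡dy (Subgroup.⁻¹∈ (multiples n) (proj₂ (W⊆ y∈W)))))
      where
      open SetoidReasoning Ω.setoid
      cancel : ∀ u v w → (u Ω.⁻¹ Ω.∙ w) Ω.∙ (v Ω.⁻¹ Ω.∙ w) Ω.⁻¹ Ω.≈ u Ω.⁻¹ Ω.∙ v
      cancel u v w = begin
        (u Ω.⁻¹ Ω.∙ w) Ω.∙ (v Ω.⁻¹ Ω.∙ w) Ω.⁻¹  ≈⟨ Ω.∙-congˡ (Ω-props.⁻¹-anti-homo-\\ v w) ⟩
        (u Ω.⁻¹ Ω.∙ w) Ω.∙ (w Ω.⁻¹ Ω.∙ v)       ≈⟨ Ω.assoc _ _ _ ⟩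
        u Ω.⁻¹ Ω.∙ (w Ω.∙ (w Ω.⁻¹ Ω.∙ v))       ≈⟨ Ω.∙-congˡ (Ω-props.\\-leftDividesˡ w v) ⟩
        u Ω.⁻¹ Ω.∙ v                            ∎
    -- If no modulus separates d(c) from b x, their difference is infinitely divisible, hence
    -- trivial, and b x is attained at `c`.
    ... | no none = ⊥-elim (missed (c , c∈ , dc≈bx))
      where
      divisible : ∀ n .{{_ : NonZero n}} → ((b • x) Ω.⁻¹ Ω.∙ ⟦ c ⟧) ∈ Multiple n
      divisible n with em {P = ((b • x) Ω.⁻¹ Ω.∙ ⟦ c ⟧) ∈ Multiple n}
      ... | yes n∣ = n∣
      ... | no  n∤ = contradiction (n , ℕ.≢-nonZero (ℕ.≢-nonZero⁻¹ n) , n∤) none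
      dc≈bx : ⟦ c ⟧ Ω.≈ b • x
      dc≈bx = Ω.trans (coset-≈ {G = Ω} (infinitely-divisible⇒ε divisible)) (Ω.identityʳ _)

    separate : ∀ c → Separated c
    separate c with em {P = c ∈ ⟪ h ⟫}
    ... | yes c∈ = close-by c∈
    ... | no  c∉ = far c∉

    modulus : Carrier → ℕ
    modulus c = proj₁ (proj₂ (proj₂ (proj₂ (separate c))))

    modulus≢0 : ∀ c → NonZero (modulus c)
    modulus≢0 c = proj₁ (proj₂ (proj₂ (proj₂ (proj₂ (separate c)))))

    close : ∀ i z n → x Ω.≈ i • ω Ω.∙ n • z → ((b • x) Ω.⁻¹ Ω.∙ ⟦ i •ᴳ h ⟧) ∈ Multiple n
    close i z n x≈ = Subgroup.resp (multiples n) (Ω-props.⁻¹-anti-homo-\\ _ _)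
      (Subgroup.⁻¹∈ (multiples n) (b • z , ≈-coset {G = Ω} (begin
        b • x                          ≈⟨ •-congʳ b x≈ ⟩
        b • (i • ω Ω.∙ n • z)          ≈⟨ •-distrib-∙ _ _ b ⟩
        b • i • ω Ω.∙ b • n • z        ≈⟨ Ω.∙-cong (•-comm b i ω) (•-comm b n z) ⟩
        i • b • ω Ω.∙ n • b • z        ≈⟨ Ω.∙-congʳ (•-congʳ i dh≈bω) ⟨
        i • ⟦ h ⟧ Ω.∙ n • b • z        ≈⟨ Ω.∙-congʳ (•-homo d i h) ⟨
        ⟦ i •ᴳ h ⟧ Ω.∙ n • b • z       ∎)))
      where open SetoidReasoning Ω.setoid

  -- Modulo N the closure of ⟨h⟩ is cyclic of P-order, and d detects such orders.
  closure∩kernel⊆normal : ∀ {h} b .{{_ : NonZero b}} → ⟦ h ⟧ Ω.≈ b • ω →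
    (N : Subgroup G g) → IsNormal N → IsOpen ⟨ N ⟩ → ∀ {c} → c ∈ ⟪ h ⟫ → ⟦ c ⟧ Ω.≈ Ω.ε → c ∈ ⟨ N ⟩
  closure∩kernel⊆normal {h} b dh≈bω N N-normal N-open {c} c∈ dc≈ε =
    -- The factor `b` of the modulus cancels against d(h) = bω, which leaves a congruence modulo `m`
    -- between the exponents `i` and `j`.
    let x , x∈ , c⁻¹x∈N , z , dc⁻¹dx≈ = approximate c∈ N-open (Subgroup.ε∈ N) (b * m)
        i , j , x∙jh≈ih = generated⇒power-quotient {G = G} x∈
        dx≈ = begin
          ⟦ x ⟧                     ≈⟨ coset-≈ {G = Ω} dc⁻¹dx≈ ⟩
          ⟦ c ⟧ Ω.∙ (b * m) • z     ≈⟨ Ω.∙-congʳ dc≈ε ⟩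
          Ω.ε Ω.∙ (b * m) • z       ≈⟨ Ω.identityˡ _ ⟩
          (b * m) • z               ≈⟨ •-assocˡ z b m ⟨
          b • m • z                 ∎
        biω≈ = begin
          b • i • ω                   ≈⟨ d-power i ⟨
          ⟦ i •ᴳ h ⟧                  ≈⟨ ⟦⟧-cong x∙jh≈ih ⟨
          ⟦ x ∙ j •ᴳ h ⟧              ≈⟨ homo _ _ ⟩
          ⟦ x ⟧ Ω.∙ ⟦ j •ᴳ h ⟧        ≈⟨ Ω.∙-cong dx≈ (d-power j) ⟩
          b • m • z Ω.∙ b • j • ω     ≈⟨ ∙-comm _ _ ⟩
          b • j • ω Ω.∙ b • m • z     ≈⟨ •-distrib-∙ _ _ b ⟨
          b • (j • ω Ω.∙ m • z)       ∎
    in coset-∈ˡ N c⁻¹x∈N (power-quotient∈ N {m} mh∈N i j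
         (supported-cong (P-number⇒supported m m-primes) {j} {i} {z} (•-cancelˡ b biω≈)) x∙jh≈ih)
    where
    open SetoidReasoning Ω.setoid
    m : ℕ
    m = proj₁ (quotients N N-normal N-open)
    m-index = proj₁ (proj₂ (quotients N N-normal N-open))
    m-primes : ∀ {p} → Prime p → p ∣ m → p ∈ P
    m-primes = proj₂ (proj₂ (quotients N N-normal N-open))
    instance
      m≢0 : NonZero m
      m≢0 = index⇒nonZero {A = whole {G = G}} {B = N} m-index
      bm≢0 : NonZero (b * m)
      bm≢0 = ℕ.m*n≢0 b m
    mh∈N : (m •ᴳ h) ∈ ⟨ N ⟩
    mh∈N = index-power∈ whole N (λ {y} _ → N-normal y) m-index _
    d-power : ∀ k → ⟦ k •ᴳ h ⟧ Ω.≈ b • k • ω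
    d-power k = Ω.trans (•-homo d k h) (Ω.trans (•-congʳ k dh≈bω) (•-comm k b ω))

  whole≐multiples : ⟨ whole {G = Ω} ⟩ ≐ Multiple 1
  whole≐multiples = (λ {x} _ → x , Ω.sym (Ω.identityʳ x)) , _

  -- Construction and uniqueness for an inertially finite subgroup

  module _ (H : Subgroup G g) (H-fin : IsInertiallyFinite H) where
    open IsInertiallyFinite H-fin

    private
      module H = Subgroup H

      instance
        f≢0 : NonZero f
        f≢0 = index⇒nonZero {A = whole {G = Ω}} {B = image d H} f-index

    image-H : ⟨ image d H ⟩ ≐ Multiple f
    image-H = subst (λ n → ⟨ image d H ⟩ ≐ Multiple n) (ℕ.*-identityˡ f)
      (index⇒multiples whole (image d H) {1} whole≐multiples _ f-index)

    d⟨h⟩⇒dh : ∀ {h y} → f • y Ω.≈ ⟦ h ⟧ → (y∈Ω⁺ : Ω⁺ y) → ⟦ h ⟧ Ω.≈ (f * Ω⁺.mult y∈Ω⁺) • ω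
    d⟨h⟩⇒dh fy≈dh y∈Ω⁺ = Ω.trans (Ω.sym fy≈dh)
      (Ω.trans (•-congʳ f (Ω⁺.x≈mult•ω y∈Ω⁺)) (•-assocˡ ω f (Ω⁺.mult y∈Ω⁺)))

    module _
      (V : Subgroup G g) (V≤H : _IsOpenSubgroupOf_ {G = G} V H)
      {h : Carrier} (h∈H : h ∈ ⟨ H ⟩) {y : Ω.Carrier} (fy≈dh : f • y Ω.≈ ⟦ h ⟧) (y∈Ω⁺ : Ω⁺ y)
      (h-normalizes : Normalizes {G = G} h (I V))
      where

      private
        module V = Subgroup V
        module I = Subgroup (inertia V)
        module C = Subgroup (closureSubgroup {G = G} h)
        open Ω⁺ y∈Ω⁺ using (mult; mult-nonZero)

        e : ℕ
        e = f * mult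

        instance
          e≢0 : NonZero e
          e≢0 = ℕ.m*n≢0 f mult

        dh≈eω : ⟦ h ⟧ Ω.≈ e • ω
        dh≈eω = d⟨h⟩⇒dh fy≈dh y∈Ω⁺

        N : Subgroup G g
        N = proj₁ (open-subgroup⇒normal V H V≤H)

        N-normal : IsNormal N
        N-normal = proj₁ (proj₂ (open-subgroup⇒normal V H V≤H))

        N-open : IsOpen ⟨ N ⟩
        N-open = proj₁ (proj₂ (proj₂ (open-subgroup⇒normal V H V≤H)))

        N∩H⊆V : ∀ {x} → x ∈ ⟨ N ⟩ → x ∈ ⟨ H ⟩ → x ∈ ⟨ V ⟩
        N∩H⊆V = proj₂ (proj₂ (proj₂ (open-subgroup⇒normal V H V≤H)))

        C⊆H : ⟪ h ⟫ ⊆ ⟨ H ⟩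
        C⊆H c∈ = closure⊆closed H closed h∈H c∈

      -- Write c = x v with x in ⟨h⟩ and v in N ∩ H ⊆ V. Conjugation by v preserves I_V because the
      -- kernel of d is normal, conjugation by x because h normalizes I_V.
      closure-normalizes : ∀ {c z} → c ∈ ⟪ h ⟫ → z ∈ I V → (c ∙ z ∙ c ⁻¹) ∈ I V
      closure-normalizes {c} {z} c∈ z∈ =
        let x , x∈ , c⁻¹x∈N , _ = approximate c∈ N-open (Subgroup.ε∈ N) 1
            v = x ⁻¹ ∙ c
            v∈V = V.resp (⁻¹-anti-homo-\\ c x)
                    (V.⁻¹∈ (N∩H⊆V c⁻¹x∈N (H.∙∈ (H.⁻¹∈ (C⊆H c∈)) (generated⊆ H h∈H x∈))))
        in I.resp (trans (sym (conj-∙ {G = G} x v z)) (conj-cong {G = G} z (\\-leftDividesˡ x c)))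
             (Equivalence.to (generated-normalizes {G = G} I.resp h-normalizes x∈ (v ∙ z ∙ v ⁻¹))
               (inertia-conj V v∈V z∈))

      private
        Product : Pred Carrier _
        Product = _·_ {G = G} ⟪ h ⟫ (I V)

        ∙-product : ∀ u z u′ z′ → u ∙ z ∙ (u′ ∙ z′) ≈ u ∙ u′ ∙ (u′ ⁻¹ ∙ z ∙ u′ ⁻¹ ⁻¹ ∙ z′)
        ∙-product u z u′ z′ = begin
          u ∙ z ∙ (u′ ∙ z′)                                 ≈⟨ assoc _ _ _ ⟨
          u ∙ z ∙ u′ ∙ z′                                   ≈⟨ ∙-congʳ (assoc _ _ _) ⟩
          u ∙ (z ∙ u′) ∙ z′                                 ≈⟨ ∙-congʳ (∙-congˡ (\\-leftDividesˡ u′ _)) ⟨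
          u ∙ (u′ ∙ (u′ ⁻¹ ∙ (z ∙ u′))) ∙ z′                ≈⟨ ∙-congʳ (assoc _ _ _) ⟨
          u ∙ u′ ∙ (u′ ⁻¹ ∙ (z ∙ u′)) ∙ z′                  ≈⟨ ∙-congʳ (∙-congˡ (assoc _ _ _)) ⟨
          u ∙ u′ ∙ (u′ ⁻¹ ∙ z ∙ u′) ∙ z′                    ≈⟨ ∙-congʳ (∙-congˡ (∙-congˡ (⁻¹-involutive u′))) ⟨
          u ∙ u′ ∙ (u′ ⁻¹ ∙ z ∙ u′ ⁻¹ ⁻¹) ∙ z′              ≈⟨ assoc _ _ _ ⟩
          u ∙ u′ ∙ (u′ ⁻¹ ∙ z ∙ u′ ⁻¹ ⁻¹ ∙ z′)              ∎
          where open SetoidReasoning setoid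

        ⁻¹-product : ∀ u z → (u ∙ z) ⁻¹ ≈ u ⁻¹ ∙ (u ∙ z ⁻¹ ∙ u ⁻¹)
        ⁻¹-product u z = begin
          (u ∙ z) ⁻¹                  ≈⟨ ⁻¹-anti-homo-∙ u z ⟩
          z ⁻¹ ∙ u ⁻¹                 ≈⟨ \\-leftDividesʳ u _ ⟨
          u ⁻¹ ∙ (u ∙ (z ⁻¹ ∙ u ⁻¹))  ≈⟨ ∙-congˡ (assoc _ _ _) ⟨
          u ⁻¹ ∙ (u ∙ z ⁻¹ ∙ u ⁻¹)    ∎
          where open SetoidReasoning setoid

      -- Excluded middle brings the predicate ⟨h⟩ᶜ · I_V down to the level of the carrier.
      frobeniusGroup : Subgroup G g
      frobeniusGroup = record
        { ⟨_⟩  = λ x → Lift g (True (em {P = x ∈ Product}))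
        ; resp = λ x≈x′ (lift x∈) →
            let u , z , u∈ , z∈ , x≈ = toWitness x∈
            in lift (fromWitness (u , z , (λ {_} → u∈) , z∈ , trans (sym x≈x′) x≈))
        ; ε∈   = lift (fromWitness (ε , ε , (λ {_} → C.ε∈) , I.ε∈ , sym (identityʳ ε)))
        ; ∙∈   = λ (lift x∈) (lift x′∈) →
            let u  , z  , u∈  , z∈  , x≈  = toWitness x∈
                u′ , z′ , u′∈ , z′∈ , x′≈ = toWitness x′∈
            in lift (fromWitness (_ , _ , (λ {_} → C.∙∈ u∈ u′∈) ,
                 I.∙∈ (closure-normalizes (C.⁻¹∈ u′∈) z∈) z′∈ ,
                 trans (∙-cong x≈ x′≈) (∙-product u z u′ z′)))
        ; ⁻¹∈  = λ (lift x∈) →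
            let u , z , u∈ , z∈ , x≈ = toWitness x∈
            in lift (fromWitness (_ , _ , (λ {_} → C.⁻¹∈ u∈) ,
                 closure-normalizes u∈ (I.⁻¹∈ z∈) , trans (⁻¹-cong x≈) (⁻¹-product u z)))
        }

      frobeniusGroup≐ : ⟨ frobeniusGroup ⟩ ≐ Product
      frobeniusGroup≐ = (λ (lift x∈) → toWitness x∈) , (λ x∈ → lift (fromWitness x∈))

      private
        S : Subgroup G g
        S = frobeniusGroup

        S-intro : ∀ {c x} → c ∈ ⟪ h ⟫ → (c ⁻¹ ∙ x) ∈ I V → x ∈ ⟨ S ⟩
        S-intro {c} {x} c∈ z∈ = proj₂ frobeniusGroup≐
          (c , c ⁻¹ ∙ x , (λ {_} → c∈) , z∈ , sym (\\-leftDividesˡ c x))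

        S⊆H : ⟨ S ⟩ ⊆ ⟨ H ⟩
        S⊆H x∈ =
          let _ , _ , c∈ , (z∈V , _) , x≈ = proj₁ frobeniusGroup≐ x∈
          in H.resp (sym x≈) (H.∙∈ (C⊆H c∈) (proj₁ V≤H z∈V))

        h∈S : h ∈ ⟨ S ⟩
        h∈S = S-intro (generated⊆closure {G = G} gen) (I.resp (sym (inverseˡ h)) I.ε∈)

      -- The closure of ⟨hᵐ⟩ lies in V and maps onto e m Ω, so it absorbs d(t) for t near 1.
      frobeniusGroup-open : S IsOpenSubgroupOf H
      frobeniusGroup-open = S⊆H , W , open-⋃ (λ (s , s∈S) → proj₁ (proj₂ (near s))) ,
        (λ {s} s∈S → ((s , s∈S) , proj₁ (proj₂ (proj₂ (near s)))) , S⊆H s∈S) ,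
        λ (((s , s∈S) , x∈) , x∈H) → absorb s∈S x∈H (proj₂ (proj₂ (proj₂ (near s))) x∈)
        where
        m : ℕ
        m = proj₁ (quotients N N-normal N-open)
        m-index = proj₁ (proj₂ (quotients N N-normal N-open))
        instance
          m≢0 : NonZero m
          m≢0 = index⇒nonZero {A = whole {G = G}} {B = N} m-index
          e*m≢0 : NonZero (e * m)
          e*m≢0 = ℕ.m*n≢0 e m
        near : ∀ s → ∃[ W ] IsOpen W ∧ s ∈ W ∧
               (∀ {x} → x ∈ W → (s ⁻¹ ∙ x) ∈ ⟨ N ⟩ ∧ (⟦ s ⟧ Ω.⁻¹ Ω.∙ ⟦ x ⟧) ∈ Multiple (e * m))
        near s = neighbourhood s N-open (Subgroup.ε∈ N) (e * m)
        W : Pred Carrier g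
        W = ⋃ (∃ ⟨ S ⟩) (λ (s , _) → proj₁ (near s))
        mh∈V : (m •ᴳ h) ∈ ⟨ V ⟩
        mh∈V = N∩H⊆V (index-power∈ whole N (λ {y} _ → N-normal y) m-index _) (•∈ H m h∈H)
        d-mh : ⟦ m •ᴳ h ⟧ Ω.≈ (e * m) • ω
        d-mh = Ω.trans (•-homo d m h) (Ω.trans (•-congʳ m dh≈eω)
                 (Ω.trans (•-comm m e ω) (•-assocˡ ω e m)))
        absorb : ∀ {s x} → s ∈ ⟨ S ⟩ → x ∈ ⟨ H ⟩ →
                 (s ⁻¹ ∙ x) ∈ ⟨ N ⟩ ∧ (⟦ s ⟧ Ω.⁻¹ Ω.∙ ⟦ x ⟧) ∈ Multiple (e * m) → x ∈ ⟨ S ⟩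
        -- Here t stands for s ⁻¹ ∙ x. Both t and `c` lie in V and agree under d, so c ⁻¹ ∙ t is in
        -- I_V; thus t, and with it x = s t, belongs to S.
        absorb {s} {x} s∈S x∈H (t∈N , z , dt≈) =
          let t∈V = N∩H⊆V t∈N (H.∙∈ (H.⁻¹∈ (S⊆H s∈S)) x∈H)
              c , c∈ , dc≈ = closure-image-surjective (e * m) d-mh z
              c∈V = closure⊆open-subgroup V H V≤H closed mh∈V c∈
          in coset-∈ʳ S (S-intro (closure-mono {G = G} (•∈ (generated h) m gen) c∈)
               (V.∙∈ (V.⁻¹∈ c∈V) t∈V ,
                equal⇒kernel (Ω.trans dc≈ (Ω.sym (Ω.trans (homo-\\ s x) dt≈))))) s∈S

      frobeniusGroup-inertia : I S ≐ I V
      frobeniusGroup-inertia = I-S⊆I-V , I-V⊆I-S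
        where
        I-S⊆I-V : I S ⊆ I V
        I-S⊆I-V {x} (x∈S , dx≈ε) =
          let c , z , c∈ , (z∈V , dz≈ε) , x≈ = proj₁ frobeniusGroup≐ x∈S
              dc≈ε = Ω.trans (Ω.sym (Ω.identityʳ _)) (Ω.trans (Ω.∙-congˡ (Ω.sym dz≈ε))
                       (Ω.trans (Ω.sym (homo c z)) (Ω.trans (⟦⟧-cong (sym x≈)) dx≈ε)))
              c∈N = closure∩kernel⊆normal e dh≈eω N N-normal N-open c∈ dc≈ε
          in V.resp (sym x≈) (V.∙∈ (N∩H⊆V c∈N (C⊆H c∈)) z∈V) , dx≈ε
        I-V⊆I-S : I V ⊆ I S
        I-V⊆I-S {x} x∈@(_ , dx≈ε) =
          proj₂ frobeniusGroup≐ (ε , x , (λ {_} → C.ε∈) , x∈ , sym (identityˡ x)) , dx≈ε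

      frobeniusGroup-image : ⟨ image d S ⟩ ≐ Multiple e
      frobeniusGroup-image =
        (λ (x , x∈S , dx≈) →
          let c , z , c∈ , (_ , dz≈ε) , x≈ = proj₁ frobeniusGroup≐ x∈S
          in Subgroup.resp (multiples e)
               (Ω.trans (Ω.sym (Ω.identityʳ _)) (Ω.trans (Ω.∙-congˡ (Ω.sym dz≈ε))
                 (Ω.trans (Ω.sym (homo c z)) (Ω.trans (⟦⟧-cong (sym x≈)) dx≈))))
               (closure-image e dh≈eω c∈)) ,
        (λ (z , w≈ez) →
          let c , c∈ , dc≈ = closure-image-surjective e dh≈eω z
          in c , S-intro c∈ (I.resp (sym (inverseˡ c)) I.ε∈) , Ω.trans dc≈ (Ω.sym w≈ez))

      frobeniusGroup-isFrobenius : IsFrobeniusGroup H-fin h V S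
      frobeniusGroup-isFrobenius = record
        { open-in = frobeniusGroup-open
        ; h∈S     = h∈S
        ; d⟨h⟩    = y
        ; d⟨h⟩-eq = fy≈dh
        ; d⟨h⟩∈Ω⁺ = y∈Ω⁺
        -- The image of S is f mult Ω. It is rewritten as a multiple of the P-part first, since the
        -- P-part is supported while `mult` itself may have prime factors outside P.
        ; f-eq    = multiples⇒index (image d H) (image d S) {{f≢0}} {{P-part-nonZero (λ _ → em) mult}}
                      (P-part-supported (λ _ → em) mult) image-H
                      ( proj₁ (multiple-P-part (λ _ → em) mult f) ∘ proj₁ frobeniusGroup-image
                      , proj₂ frobeniusGroup-image ∘ proj₂ (multiple-P-part (λ _ → em) mult f) )
        ; I-eq    = frobeniusGroup-inertia
        }

      frobeniusGroup-unique : ∀ S′ → IsFrobeniusGroup H-fin h V S′ → ⟨ S′ ⟩ ≐ ⟨ S ⟩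
      frobeniusGroup-unique S′ S′-frob = S′⊆S , S⊆S′
        where
        module S′ = Subgroup S′
        module F = IsFrobeniusGroup S′-frob
        -- `S′` brings its own multiplicity. It is never compared with `mult`: the surjectivity of d
        -- from C onto f n′ Ω is applied afresh with `n′`.
        n′ : ℕ
        n′ = Ω⁺.mult F.d⟨h⟩∈Ω⁺
        instance
          n′≢0 : NonZero n′
          n′≢0 = Ω⁺.mult-nonZero F.d⟨h⟩∈Ω⁺

        C⊆S′ : ⟪ h ⟫ ⊆ ⟨ S′ ⟩
        C⊆S′ c∈ = closure⊆open-subgroup S′ H F.open-in closed F.h∈S c∈

        S⊆S′ : ⟨ S ⟩ ⊆ ⟨ S′ ⟩
        S⊆S′ x∈ =
          let _ , _ , c∈ , z∈ , x≈ = proj₁ frobeniusGroup≐ x∈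
          in S′.resp (sym x≈) (S′.∙∈ (C⊆S′ c∈) (proj₁ (proj₂ F.I-eq z∈)))

        image-S′ : ⟨ image d S′ ⟩ ⊆ Multiple (f * n′)
        image-S′ = proj₂ (multiple-P-part (λ _ → em) n′ f) ∘ proj₁ (index⇒multiples (image d H) (image d S′) {f}
          image-H (λ (x , x∈ , dx≈) → x , proj₁ F.open-in x∈ , dx≈) F.f-eq)

        S′⊆S : ⟨ S′ ⟩ ⊆ ⟨ S ⟩
        S′⊆S {x} x∈ =
          let z , dx≈ = image-S′ (x , x∈ , Ω.refl)
              c , c∈ , dc≈ = closure-image-surjective (f * n′) (d⟨h⟩⇒dh F.d⟨h⟩-eq F.d⟨h⟩∈Ω⁺) z
          in S-intro c∈ (proj₁ F.I-eq
               (S′.∙∈ (S′.⁻¹∈ (C⊆S′ c∈)) x∈ , equal⇒kernel (Ω.trans dc≈ (Ω.sym dx≈))))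

theorem4p4p5 : (em : ∀ {ℓ} → ExcludedMiddle ℓ) →
    ∀ {g o} →
    (P : Pred ℕ 0ℓ) → P ⊆ Prime →
    (G : TopologicalGroup g) → IsPro G P →
    (Ω : TopologicalGroup o) → Ω ≅ ℤ[ P ] →
    (ω : TopologicalGroup.Carrier Ω) → IsTopologicalGenerator Ω ω →
    (d : ContinuousHom G Ω) → d IsSurjective →
    let open Frobenius {P = P} (λ _ → em) ω d in
    (H : Subgroup G g) (H-fin : IsInertiallyFinite H) →
    (V : Subgroup G g) → V IsOpenSubgroupOf H →
    (h : TopologicalGroup.Carrier G) → h ∈ ⟨ H ⟩ → d⟨_⟩∈Ω⁺ H-fin h →
    Normalizes {G = G} h (I V) →
    Σ[ S ∈ Subgroup G g ]
    (IsFrobeniusGroup H-fin h V S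
    ∧ (∀ (S′ : Subgroup G g) → IsFrobeniusGroup H-fin h V S′ → ⟨ S′ ⟩ ≐ ⟨ S ⟩)
    ∧ ⟨ S ⟩ ≐ _·_ {G = G} (⟨_⟩ᶜ {G = G} h) (I V))
theorem4p4p5 em P P⊆Prime G G-pro Ω Ω≅ℤP ω ω-generates d _ H H-fin V V≤H h h∈H (y , fy≈dh , y∈Ω⁺) h-normalizes =
  M.frobeniusGroup H H-fin V V≤H h∈H fy≈dh y∈Ω⁺ h-normalizes ,
  M.frobeniusGroup-isFrobenius H H-fin V V≤H h∈H fy≈dh y∈Ω⁺ h-normalizes ,
  M.frobeniusGroup-unique H H-fin V V≤H h∈H fy≈dh y∈Ω⁺ h-normalizes ,
  M.frobeniusGroup≐ H H-fin V V≤H h∈H fy≈dh y∈Ω⁺ h-normalizes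
  where module M = FrobeniusGroup em P P⊆Prime G G-pro Ω Ω≅ℤP ω ω-generates d
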